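{- For any $k \geq 5$ and $n \geq 1$, $$sat(K_k^n, C_4) = \left\lfloor \frac{3(k-1)n -2}{2} \right\rfloor,$$ which equals $\frac{3}{2}(k-1)n - \frac{3}{2}$ if $k$ is even and $n$ is odd, and equals $\frac{3}{2}(k-1)n - 1$ otherwise. Moreover, for every $n\ge 1$, $\lfloor \frac{9}{2}n-1 \rfloor \leq sat(K_4^n, C_4) \leq 5n-1$.
   Context: All graphs are finite, simple and undirected. $K_k^n$ denotes the complete $k$-partite graph with exactly $n$ vertices in each of its $k$ parts. $C_4$ is the cycle on $4$ vertices. For graphs $G$ and $F$, a spanning subgraph $H$ of $G$ is $F$-saturated relative to $G$ if $H$ contains no copy of $F$ but $H+e$ contains a copy of $F$ for every $e\in E(G)\setminus E(H)$; $sat(G,F)$ is the minimum number of edges of a graph that is $F$-saturated relative to $G$. -}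

module Defs where

open import Data.Nat using (ℕ; zero; suc; _+_; _*_; _∸_; _≤_; ⌊_/2⌋)
open import Data.Bool using (Bool; true; false; not; if_then_else_)
open import Data.Fin using (Fin; _≟_)
open import Data.List using (List; map; cartesianProduct; allFin)
open import Data.Nat.ListAction using (sum)
open import Data.Product using (Σ; ∃; _×_; _,_; proj₁; proj₂)
open import Data.Sum using (_⊎_)
open import Relation.Nullary using (¬_; does)
open import Relation.Binary.PropositionalEquality using (_≡_; _≢_)

record Graph (V : Set) : Set where
  field
    adj    : V → V → Bool
    sym    : ∀ x y → adj x y ≡ adj y x
    irrefl : ∀ x → adj x x ≡ false
open Graph public

-- Vertex set of K_k^n : (part index, index within part).
Vtx : ℕ → ℕ → Set
Vtx k n = Fin k × Fin n

vertices : (k n : ℕ) → List (Vtx k n)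
vertices k n = cartesianProduct (allFin k) (allFin n)

Kadj : (k n : ℕ) → Vtx k n → Vtx k n → Bool
Kadj k n (i , _) (j , _) = not (does (i ≟ j))

Kadj-sym : (k n : ℕ) → ∀ x y → Kadj k n x y ≡ Kadj k n y x
Kadj-sym k n (i , a) (j , b) with i ≟ j | j ≟ i
... | Relation.Nullary.yes _ | Relation.Nullary.yes _ = Relation.Binary.PropositionalEquality.refl
... | Relation.Nullary.no _  | Relation.Nullary.no _  = Relation.Binary.PropositionalEquality.refl
... | Relation.Nullary.yes p | Relation.Nullary.no q  = Data.Empty.⊥-elim (q (Relation.Binary.PropositionalEquality.sym p))
  where import Data.Empty
... | Relation.Nullary.no q  | Relation.Nullary.yes p = Data.Empty.⊥-elim (q (Relation.Binary.PropositionalEquality.sym p))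
  where import Data.Empty

Kadj-irrefl : (k n : ℕ) → ∀ x → Kadj k n x x ≡ false
Kadj-irrefl k n (i , a) with i ≟ i
... | Relation.Nullary.yes _ = Relation.Binary.PropositionalEquality.refl
... | Relation.Nullary.no q  = Data.Empty.⊥-elim (q Relation.Binary.PropositionalEquality.refl)
  where import Data.Empty

K : (k n : ℕ) → Graph (Vtx k n)
K k n = record { adj = Kadj k n ; sym = Kadj-sym k n ; irrefl = Kadj-irrefl k n }

b2n : Bool → ℕ
b2n b = if b then 1 else 0

edges : {k n : ℕ} → Graph (Vtx k n) → ℕ
edges {k} {n} H =
  ⌊ sum (map (λ p → b2n (adj H (proj₁ p) (proj₂ p)))
             (cartesianProduct (vertices k n) (vertices k n))) /2⌋

E : {V : Set} → Graph V → V → V → Set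
E H x y = adj H x y ≡ true

Eplus : {V : Set} → Graph V → V → V → V → V → Set
Eplus H u v x y = E H x y ⊎ ((x ≡ u × y ≡ v) ⊎ (x ≡ v × y ≡ u))

HasC4 : {V : Set} → (V → V → Set) → Set
HasC4 {V} R = Σ V λ a → Σ V λ b → Σ V λ c → Σ V λ d →
  (a ≢ b × a ≢ c × a ≢ d × b ≢ c × b ≢ d × c ≢ d) ×
  (R a b × R b c × R c d × R d a)

_⊆G_ : {V : Set} → Graph V → Graph V → Set
H ⊆G G = ∀ x y → E H x y → E G x y

C4Saturated : {V : Set} → Graph V → Graph V → Set
C4Saturated H G =
  (H ⊆G G) × ¬ HasC4 (E H) ×
  (∀ u v → E G u v → adj H u v ≡ false → HasC4 (Eplus H u v))

SatK-C4 : (k n s : ℕ) → Set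
SatK-C4 k n s =
  (Σ (Graph (Vtx k n)) λ H → C4Saturated H (K k n) × edges H ≡ s) ×
  (∀ (H : Graph (Vtx k n)) → C4Saturated H (K k n) → s ≤ edges H)

{-# OPTIONS --safe #-}
-- Lower bound.  With D the sum of the degrees and N = k n, it suffices that
-- 3 N ≤ D + 3 n + 3: the handshake lemma supplies the rounding.  Every edge hands
-- its two units to its ends, so that the units add up to D, in such a way that
-- all but a controlled set of vertices obtain three.
--   * If there is a leaf, with neighbour s and in part P, then every vertex outside
--     P is within distance 2 of s.  An edge between two distances from s is given
--     to the farther end.  The vertices outside P that fall short lie at distance 2
--     and in at most two parts, since parents of short vertices of different parts
--     are adjacent and a triangle of parents would close a C₄ through s.
--   * If no degree is below 3, nothing is short.  Otherwise let v have exactly the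
--     neighbours a and b; both give to their other neighbours, and these give to the
--     farther vertices of degree 2.  If a ≁ b, only part P of v and a, b are short.
--     If all vertices of degree 2 lie in triangles, the remaining short neighbours
--     of a lie in one part, and so do those of b.
--
-- Upper bound.  A triangle with pendant triangles and leaves at its corners, all
-- leaves at a corner lying in the same part, is saturated, and D = 3 N - 3 - L for L
-- leaves.  Taking whole parts as the leaves of a corner gives L = 3 n, or 3 n - 1
-- when the parity of D leaves one unit of slack.
module Submission where

open import Defs hiding (sym)
open import Data.Nat using (ℕ; zero; suc; _+_; _*_; _∸_; _≤_; _<_; z≤n; s≤s; ⌊_/2⌋; parity)
import Data.Nat as ℕ
open import Data.Nat.Properties
  using (module ≤-Reasoning; +-comm; +-assoc; +-identityʳ; +-cancelʳ-≡; +-cancelʳ-≤; +-mono-≤;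
         +-monoˡ-≤; +-monoʳ-≤; *-comm; *-zeroʳ; *-identityˡ; *-identityʳ; *-distribˡ-+;
         *-cancelˡ-≡; *-monoʳ-≤; ∸-monoˡ-≤; m+n∸n≡m; ≤-refl; ≤-reflexive; ≤-trans; ≤-antisym;
         <-asym; <-irrefl; m≤m+n; m≤n+m; n≤1+n; ⌊n/2⌋-mono)
open import Data.Nat.Divisibility using (divides; ∣1⇒≡1; ∣m+n∣m⇒∣n; m∣m*n)
open import Data.Nat.ListAction using (sum)
open import Data.Nat.ListAction.Properties using (sum-++)
open import Data.Nat.Tactic.RingSolver using (solve-∀)
open import Data.Parity.Base using (0ℙ; 1ℙ) renaming (_⁻¹ to opposite)
open import Data.Parity.Properties using (suc-homo-⁻¹)
open import Data.Bool using (Bool; true; false)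
import Data.Bool.Properties as Bool
open import Data.Fin using (Fin; zero; suc; _≟_; toℕ; combine; remQuot; splitAt; join; _↑ˡ_; _↑ʳ_)
open import Data.Fin.Properties
  using (any?; all?; suc-injective; combine-remQuot; remQuot-combine; toℕ-combine; join-splitAt; splitAt-↑ʳ;
         splitAt-↑ˡ)
open import Data.List using (List; []; _∷_; _++_; map; allFin; cartesianProduct)
open import Data.List.Properties using (map-++; map-∘; map-tabulate)
open import Data.Product using (Σ; ∃; ∃₂; _×_; _,_; proj₁; proj₂)
open import Data.Product.Properties using (≡-dec)
open import Data.Sum using (_⊎_; inj₁; inj₂; [_,_]′)
open import Data.Sum.Properties using (inj₂-injective)
open import Data.Empty using (⊥; ⊥-elim)
open import Function using (_∘_; id; mk⇔)
open import Relation.Nullary using (¬_; Dec; yes; no; does)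
open import Relation.Nullary.Decidable
  using (map′; ¬?; _×-dec_; _⊎-dec_; _→-dec_; decidable-stable; toSum; toWitness; dec-true;
         dec-false; does-⇔)
open import Relation.Binary using (DecidableEquality)
open import Relation.Unary using (Decidable)
open import Relation.Binary.PropositionalEquality
  using (_≡_; _≢_; refl; sym; trans; cong; cong₂; subst; subst₂; module ≡-Reasoning)

private
  variable
    A B : Set

-- Finite sums, parity and halving.

∑ : List A → (A → ℕ) → ℕ
∑ xs f = sum (map f xs)

⟦_⟧ : {P : Set} → Dec P → ℕ
⟦ d ⟧ = b2n (does d)

from-does : {P : Set} (d : Dec P) → does d ≡ true → P
from-does (yes p) _  = p
from-does (no _)  ()

1≤⟦_⟧ : {P : Set} (d : Dec P) → P → 1 ≤ ⟦ d ⟧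
1≤⟦ d ⟧ p rewrite dec-true d p = ≤-refl

≤-left : ∀ {c} a {b} → c ≤ a → c ≤ a + b
≤-left a c≤a = ≤-trans c≤a (m≤m+n a _)

≤-right : ∀ {c} a {b} → c ≤ b → c ≤ a + b
≤-right a c≤b = ≤-trans c≤b (m≤n+m _ a)

∑-mono : (xs : List A) {f g : A → ℕ} → (∀ x → f x ≤ g x) → ∑ xs f ≤ ∑ xs g
∑-mono []       f≤g = z≤n
∑-mono (x ∷ xs) f≤g = +-mono-≤ (f≤g x) (∑-mono xs f≤g)

∑-cong : (xs : List A) {f g : A → ℕ} → (∀ x → f x ≡ g x) → ∑ xs f ≡ ∑ xs g
∑-cong []       f≡g = refl
∑-cong (x ∷ xs) f≡g = cong₂ _+_ (f≡g x) (∑-cong xs f≡g)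

∑-+ : (xs : List A) (f g : A → ℕ) → ∑ xs (λ x → f x + g x) ≡ ∑ xs f + ∑ xs g
∑-+ []       f g = refl
∑-+ (x ∷ xs) f g rewrite ∑-+ xs f g = interchange (f x) (g x) (∑ xs f) (∑ xs g)
  where
  interchange : ∀ a b c d → a + b + (c + d) ≡ a + c + (b + d)
  interchange = solve-∀

∑-* : (xs : List A) (c : ℕ) (f : A → ℕ) → ∑ xs (λ x → c * f x) ≡ c * ∑ xs f
∑-* []       c f = sym (*-zeroʳ c)
∑-* (x ∷ xs) c f rewrite ∑-* xs c f = sym (*-distribˡ-+ c (f x) (∑ xs f))

∑-zero : (xs : List A) → ∑ xs (λ _ → 0) ≡ 0
∑-zero []       = refl
∑-zero (_ ∷ xs) = ∑-zero xs

∑-swap : (xs : List A) (ys : List B) (f : A → B → ℕ) →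
         ∑ xs (λ x → ∑ ys (f x)) ≡ ∑ ys (λ y → ∑ xs (λ x → f x y))
∑-swap []       ys f = sym (∑-zero ys)
∑-swap (x ∷ xs) ys f rewrite ∑-swap xs ys f = sym (∑-+ ys (f x) (λ y → ∑ xs (λ x → f x y)))

∑-cartesianProduct : (xs : List A) (ys : List B) (f : A × B → ℕ) →
                     ∑ (cartesianProduct xs ys) f ≡ ∑ xs (λ x → ∑ ys (λ y → f (x , y)))
∑-cartesianProduct []       ys f = refl
∑-cartesianProduct (x ∷ xs) ys f = begin
  sum (map f (map (x ,_) ys ++ rest))           ≡⟨ cong sum (map-++ f (map (x ,_) ys) rest) ⟩
  sum (map f (map (x ,_) ys) ++ map f rest)     ≡⟨ sum-++ (map f (map (x ,_) ys)) (map f rest) ⟩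
  sum (map f (map (x ,_) ys)) + ∑ rest f        ≡⟨ cong₂ (λ l m → sum l + m) (sym (map-∘ ys)) (∑-cartesianProduct xs ys f) ⟩
  ∑ ys (λ y → f (x , y)) + ∑ xs (λ z → ∑ ys (λ y → f (z , y))) ∎
  where
  open ≡-Reasoning
  rest = cartesianProduct xs ys

∑-allFin-suc : ∀ k (f : Fin (suc k) → ℕ) → ∑ (allFin (suc k)) f ≡ f zero + ∑ (allFin k) (f ∘ suc)
∑-allFin-suc k f = cong (λ l → f zero + sum l)
  (trans (map-tabulate {n = k} suc f) (sym (map-tabulate {n = k} id (f ∘ suc))))

∑-allFin-const : ∀ k c → ∑ (allFin k) (λ _ → c) ≡ k * c
∑-allFin-const zero    c = refl
∑-allFin-const (suc k) c = trans (∑-allFin-suc k (λ _ → c)) (cong (c +_) (∑-allFin-const k c))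

∑-allFin-δ : ∀ {k} (a : Fin k) → ∑ (allFin k) (λ i → ⟦ i ≟ a ⟧) ≡ 1
∑-allFin-δ {suc k} zero    =
  trans (∑-allFin-suc k (λ i → ⟦ i ≟ zero ⟧)) (cong suc (∑-zero (allFin k)))
∑-allFin-δ {suc k} (suc a) =
  trans (∑-allFin-suc k (λ i → ⟦ i ≟ suc a ⟧)) (∑-allFin-δ a)

Even : ℕ → Set
Even m = ∃ λ q → m ≡ q + q

-- Handshake lemma by induction on the list: splitting off the head `x` removes its row and its
-- column, which agree by symmetry, while the diagonal entry vanishes.
∑∑-sym-even : (xs : List A) (f : A → A → ℕ) → (∀ x y → f x y ≡ f y x) → (∀ x → f x x ≡ 0) →
              Even (∑ xs (λ x → ∑ xs (f x)))
∑∑-sym-even []       f f-sym f-irr = 0 , refl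
∑∑-sym-even (x ∷ xs) f f-sym f-irr with ∑∑-sym-even xs f f-sym f-irr
... | q , eq = ∑ xs (f x) + q , (begin
  f x x + ∑ xs (f x) + ∑ xs (λ z → f z x + ∑ xs (f z))
    ≡⟨ cong₂ (λ a b → a + ∑ xs (f x) + b) (f-irr x) (∑-+ xs (λ z → f z x) (λ z → ∑ xs (f z))) ⟩
  ∑ xs (f x) + (∑ xs (λ z → f z x) + ∑ xs (λ z → ∑ xs (f z)))
    ≡⟨ cong₂ (λ a b → ∑ xs (f x) + (a + b)) (∑-cong xs (λ z → f-sym z x)) eq ⟩
  ∑ xs (f x) + (∑ xs (f x) + (q + q))
    ≡⟨ regroup (∑ xs (f x)) q ⟩
  ∑ xs (f x) + q + (∑ xs (f x) + q) ∎)
  where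
  open ≡-Reasoning
  regroup : ∀ a q → a + (a + (q + q)) ≡ a + q + (a + q)
  regroup = solve-∀

⌊q+q/2⌋ : ∀ q → ⌊ q + q /2⌋ ≡ q
⌊q+q/2⌋ zero    = refl
⌊q+q/2⌋ (suc q) rewrite +-comm q (suc q) = cong suc (⌊q+q/2⌋ q)

⌊1+q+q/2⌋ : ∀ q → ⌊ suc (q + q) /2⌋ ≡ q
⌊1+q+q/2⌋ zero    = refl
⌊1+q+q/2⌋ (suc q) rewrite +-comm q (suc q) = cong suc (⌊1+q+q/2⌋ q)

-- Searching and summing over the vertices of the complete multipartite graph.

module Vertices {k n : ℕ} where

  V : Set
  V = Vtx k n

  _≟ᵛ_ : DecidableEquality V
  _≟ᵛ_ = ≡-dec _≟_ _≟_

  anyᵛ? : {P : V → Set} → Decidable P → Dec (∃ P)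
  anyᵛ? P? = map′ (λ (i , j , p) → (i , j) , p) (λ ((i , j) , p) → i , j , p)
                  (any? (λ i → any? (λ j → P? (i , j))))

  allᵛ? : {P : V → Set} → Decidable P → Dec (∀ v → P v)
  allᵛ? P? = map′ (λ h (i , j) → h i j) (λ h i j → h (i , j))
                  (all? (λ i → all? (λ j → P? (i , j))))

  counterexample : {P : V → Set} → Decidable P → ¬ (∀ v → P v) → ∃ (¬_ ∘ P)
  counterexample P? ¬∀ with anyᵛ? (¬? ∘ P?)
  ... | yes e = e
  ... | no ¬e = ⊥-elim (¬∀ (λ v → decidable-stable (P? v) (λ ¬p → ¬e (v , ¬p))))

  vs : List V
  vs = vertices k n

  ∑-vertices : (f : V → ℕ) → ∑ vs f ≡ ∑ (allFin k) (λ i → ∑ (allFin n) (λ j → f (i , j)))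
  ∑-vertices = ∑-cartesianProduct (allFin k) (allFin n)

  ∑-const : ∀ c → ∑ vs (λ _ → c) ≡ c * (k * n)
  ∑-const c = begin
    ∑ vs (λ _ → c)                                       ≡⟨ ∑-vertices (λ _ → c) ⟩
    ∑ (allFin k) (λ _ → ∑ (allFin n) (λ _ → c))          ≡⟨ ∑-allFin-const k _ ⟩
    k * ∑ (allFin n) (λ _ → c)                           ≡⟨ cong (k *_) (∑-allFin-const n c) ⟩
    k * (n * c)                                          ≡⟨ rearrange k n c ⟩
    c * (k * n)                                          ∎
    where
    open ≡-Reasoning
    rearrange : ∀ k n c → k * (n * c) ≡ c * (k * n)
    rearrange = solve-∀

  ∑-part : (P : Fin k) → ∑ vs (λ v → ⟦ proj₁ v ≟ P ⟧) ≡ n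
  ∑-part P = begin
    ∑ vs (λ v → ⟦ proj₁ v ≟ P ⟧)                         ≡⟨ ∑-vertices _ ⟩
    ∑ (allFin k) (λ i → ∑ (allFin n) (λ _ → ⟦ i ≟ P ⟧))  ≡⟨ ∑-cong (allFin k) (λ i → ∑-allFin-const n _) ⟩
    ∑ (allFin k) (λ i → n * ⟦ i ≟ P ⟧)                   ≡⟨ ∑-* (allFin k) n _ ⟩
    n * ∑ (allFin k) (λ i → ⟦ i ≟ P ⟧)                   ≡⟨ cong (n *_) (∑-allFin-δ P) ⟩
    n * 1                                                ≡⟨ *-identityʳ n ⟩
    n                                                    ∎
    where open ≡-Reasoning

  ∑-δ : (a : V) → ∑ vs (λ v → ⟦ v ≟ᵛ a ⟧) ≡ 1
  ∑-δ (a , b) = begin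
    ∑ vs (λ v → ⟦ v ≟ᵛ (a , b) ⟧)
      ≡⟨ ∑-vertices _ ⟩
    ∑ (allFin k) (λ i → ∑ (allFin n) (λ j → ⟦ (i , j) ≟ᵛ (a , b) ⟧))
      ≡⟨ ∑-cong (allFin k) (λ i → ∑-cong (allFin n) (δ-× i)) ⟩
    ∑ (allFin k) (λ i → ∑ (allFin n) (λ j → ⟦ i ≟ a ⟧ * ⟦ j ≟ b ⟧))
      ≡⟨ ∑-cong (allFin k) (λ i → ∑-* (allFin n) ⟦ i ≟ a ⟧ _) ⟩
    ∑ (allFin k) (λ i → ⟦ i ≟ a ⟧ * ∑ (allFin n) (λ j → ⟦ j ≟ b ⟧))
      ≡⟨ ∑-cong (allFin k) (λ i → trans (cong (⟦ i ≟ a ⟧ *_) (∑-allFin-δ b)) (*-identityʳ _)) ⟩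
    ∑ (allFin k) (λ i → ⟦ i ≟ a ⟧)
      ≡⟨ ∑-allFin-δ a ⟩
    1 ∎
    where
    open ≡-Reasoning
    -- Stated for arbitrary decisions, so that the case split does not depend on how `≡-dec`
    -- computes.
    δ-pair : ∀ {i j} (d : Dec ((i , j) ≡ (a , b))) (d₁ : Dec (i ≡ a)) (d₂ : Dec (j ≡ b)) →
             ⟦ d ⟧ ≡ ⟦ d₁ ⟧ * ⟦ d₂ ⟧
    δ-pair (yes _)    (yes _)    (yes _)    = refl
    δ-pair (yes refl) (no i≢i)   _          = ⊥-elim (i≢i refl)
    δ-pair (yes refl) (yes _)    (no j≢j)   = ⊥-elim (j≢j refl)
    δ-pair (no ≢)     (yes refl) (yes refl) = ⊥-elim (≢ refl)
    δ-pair (no _)     (yes _)    (no _)     = refl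
    δ-pair (no _)     (no _)     _          = refl
    δ-× : ∀ i j → ⟦ (i , j) ≟ᵛ (a , b) ⟧ ≡ ⟦ i ≟ a ⟧ * ⟦ j ≟ b ⟧
    δ-× i j = δ-pair ((i , j) ≟ᵛ (a , b)) (i ≟ a) (j ≟ b)

  ∑-c*δ : ∀ c a → ∑ vs (λ v → c * ⟦ v ≟ᵛ a ⟧) ≡ c
  ∑-c*δ c a = trans (∑-* vs c _) (trans (cong (c *_) (∑-δ a)) (*-identityʳ c))

  -- `f` dominates the indicator of `a` with weight `f a`. In `∑-two` and `∑-three` it dominates the
  -- sum of such weighted indicators because the points are distinct.
  ∑-one : (f : V → ℕ) (a : V) → f a ≤ ∑ vs f
  ∑-one f a = ≤-trans (≤-reflexive (sym (∑-c*δ (f a) a))) (∑-mono vs pointwise)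
    where
    pointwise : ∀ v → f a * ⟦ v ≟ᵛ a ⟧ ≤ f v
    pointwise v with v ≟ᵛ a
    ... | yes refl = ≤-reflexive (*-identityʳ (f a))
    ... | no  _    = ≤-trans (≤-reflexive (*-zeroʳ (f a))) z≤n

  ∑-two : (f : V → ℕ) {a b : V} → a ≢ b → f a + f b ≤ ∑ vs f
  ∑-two f {a} {b} a≢b = begin
    f a + f b                                             ≡⟨ cong₂ _+_ (sym (∑-c*δ (f a) a)) (sym (∑-c*δ (f b) b)) ⟩
    ∑ vs (λ v → f a * ⟦ v ≟ᵛ a ⟧) + ∑ vs (λ v → f b * ⟦ v ≟ᵛ b ⟧) ≡⟨ sym (∑-+ vs _ _) ⟩
    ∑ vs (λ v → f a * ⟦ v ≟ᵛ a ⟧ + f b * ⟦ v ≟ᵛ b ⟧)      ≤⟨ ∑-mono vs pointwise ⟩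
    ∑ vs f                                                ∎
    where
    open ≤-Reasoning
    pointwise : ∀ v → f a * ⟦ v ≟ᵛ a ⟧ + f b * ⟦ v ≟ᵛ b ⟧ ≤ f v
    pointwise v with v ≟ᵛ a | v ≟ᵛ b
    ... | yes refl | yes refl = ⊥-elim (a≢b refl)
    ... | yes refl | no  _ rewrite *-identityʳ (f a) | *-zeroʳ (f b) | +-identityʳ (f a) = ≤-refl
    ... | no  _    | yes refl rewrite *-identityʳ (f b) | *-zeroʳ (f a) = ≤-refl
    ... | no  _    | no  _ rewrite *-zeroʳ (f a) | *-zeroʳ (f b) = z≤n

  ∑-three : (f : V → ℕ) {a b c : V} → a ≢ b → a ≢ c → b ≢ c → f a + f b + f c ≤ ∑ vs f
  ∑-three f {a} {b} {c} a≢b a≢c b≢c = begin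
    f a + f b + f c
      ≡⟨ cong₂ _+_ (cong₂ _+_ (sym (∑-c*δ (f a) a)) (sym (∑-c*δ (f b) b))) (sym (∑-c*δ (f c) c)) ⟩
    ∑ vs (λ v → f a * ⟦ v ≟ᵛ a ⟧) + ∑ vs (λ v → f b * ⟦ v ≟ᵛ b ⟧) + ∑ vs (λ v → f c * ⟦ v ≟ᵛ c ⟧)
      ≡⟨ cong (_+ ∑ vs (λ v → f c * ⟦ v ≟ᵛ c ⟧)) (sym (∑-+ vs _ _)) ⟩
    ∑ vs (λ v → f a * ⟦ v ≟ᵛ a ⟧ + f b * ⟦ v ≟ᵛ b ⟧) + ∑ vs (λ v → f c * ⟦ v ≟ᵛ c ⟧)
      ≡⟨ sym (∑-+ vs _ _) ⟩
    ∑ vs (λ v → f a * ⟦ v ≟ᵛ a ⟧ + f b * ⟦ v ≟ᵛ b ⟧ + f c * ⟦ v ≟ᵛ c ⟧)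
      ≤⟨ ∑-mono vs pointwise ⟩
    ∑ vs f ∎
    where
    open ≤-Reasoning
    pointwise : ∀ v → f a * ⟦ v ≟ᵛ a ⟧ + f b * ⟦ v ≟ᵛ b ⟧ + f c * ⟦ v ≟ᵛ c ⟧ ≤ f v
    pointwise v with v ≟ᵛ a | v ≟ᵛ b | v ≟ᵛ c
    ... | yes refl | yes refl | _        = ⊥-elim (a≢b refl)
    ... | yes refl | no  _    | yes refl = ⊥-elim (a≢c refl)
    ... | no  _    | yes refl | yes refl = ⊥-elim (b≢c refl)
    ... | yes refl | no  _    | no  _
      rewrite *-identityʳ (f a) | *-zeroʳ (f b) | *-zeroʳ (f c) | +-identityʳ (f a) | +-identityʳ (f a) = ≤-refl
    ... | no  _    | yes refl | no  _
      rewrite *-identityʳ (f b) | *-zeroʳ (f a) | *-zeroʳ (f c) | +-identityʳ (f b) = ≤-refl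
    ... | no  _    | no  _    | yes refl
      rewrite *-identityʳ (f c) | *-zeroʳ (f a) | *-zeroʳ (f b) = ≤-refl
    ... | no  _    | no  _    | no  _
      rewrite *-zeroʳ (f a) | *-zeroʳ (f b) | *-zeroʳ (f c) = z≤n

  part≢⇒K : ∀ {u v} → proj₁ u ≢ proj₁ v → E (K k n) u v
  part≢⇒K {u} {v} u≢v with proj₁ u ≟ proj₁ v
  ... | yes eq = ⊥-elim (u≢v eq)
  ... | no  _  = refl

  K⇒part≢ : ∀ {u v} → E (K k n) u v → proj₁ u ≢ proj₁ v
  K⇒part≢ {u} {v} kuv eq with proj₁ u ≟ proj₁ v
  ... | no ≢ = ≢ eq
  K⇒part≢ {u} {v} () eq | yes _

  -- `P` is a default value for the case that no vertex satisfies `B`.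
  cover-by-one : {B : V → Set} → Decidable B → Fin k →
    (∀ {x y} → B x → B y → proj₁ x ≡ proj₁ y) →
    ∃ λ Q → ∀ {x} → B x → proj₁ x ≡ Q
  cover-by-one B? P same with anyᵛ? B?
  ... | yes (x , bx) = proj₁ x , λ by → same by bx
  ... | no  ¬b       = P , λ {x} bx → ⊥-elim (¬b (x , bx))

  -- `Q` is the part of any vertex `x` satisfying `B`. Those outside `Q` all lie in one part, since
  -- two of them in different parts would form a forbidden triple with `x`.
  cover-by-two : {B : V → Set} → Decidable B → Fin k →
    (∀ {x y z} → B x → B y → B z → proj₁ x ≢ proj₁ y → proj₁ x ≢ proj₁ z → proj₁ y ≢ proj₁ z → ⊥) →
    ∃₂ λ Q R → ∀ {x} → B x → proj₁ x ≡ Q ⊎ proj₁ x ≡ R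
  cover-by-two {B} B? P no-three with anyᵛ? B?
  ... | no  ¬b       = P , P , λ {x} bx → ⊥-elim (¬b (x , bx))
  ... | yes (x , bx) with cover-by-one {B = λ y → B y × proj₁ x ≢ proj₁ y}
                            (λ y → B? y ×-dec ¬? (proj₁ x ≟ proj₁ y)) P same
    where
    same : ∀ {y z} → B y × proj₁ x ≢ proj₁ y → B z × proj₁ x ≢ proj₁ z → proj₁ y ≡ proj₁ z
    same {y} {z} (by , x≁y) (bz , x≁z) =
      decidable-stable (proj₁ y ≟ proj₁ z) (no-three bx by bz x≁y x≁z)
  ... | R , covers = proj₁ x , R , λ {y} by → split y by (proj₁ x ≟ proj₁ y)
    where
    split : ∀ y → B y → Dec (proj₁ x ≡ proj₁ y) → proj₁ y ≡ proj₁ x ⊎ proj₁ y ≡ R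
    split y by (yes eq) = inj₁ (sym eq)
    split y by (no ≢)   = inj₂ (covers (by , ≢))

  degreeSum : Graph V → ℕ
  degreeSum H = ∑ vs (λ u → ∑ vs (λ w → b2n (adj H u w)))

  edges-degreeSum : (H : Graph V) → edges H ≡ ⌊ degreeSum H /2⌋
  edges-degreeSum H = cong ⌊_/2⌋ (∑-cartesianProduct vs vs _)

  degreeSum-even : (H : Graph V) → Even (degreeSum H)
  degreeSum-even H = ∑∑-sym-even vs (λ u w → b2n (adj H u w))
    (λ u w → cong b2n (Graph.sym H u w)) (λ u → cong b2n (irrefl H u))

-- Discharging.

-- Every edge carries two units, one for each end; an end that gives to the
-- other passes its unit on.
module Discharging {k n : ℕ} (H : Graph (Vtx k n))
  (Gives : Vtx k n → Vtx k n → Set) (gives? : ∀ w u → Dec (Gives w u)) where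
  open Vertices {k} {n}

  -- What `u` obtains from an edge `uw`. Gifts in both directions cancel, so the two shares of an
  -- edge add up to 2 for every relation `Gives`; because of the `suc` the subtraction is never
  -- truncated.
  share : V → V → ℕ
  share w u = suc ⟦ gives? w u ⟧ ∸ ⟦ gives? u w ⟧

  receive : V → ℕ
  receive u = ∑ vs (λ w → b2n (adj H u w) * share w u)

  share-sum : ∀ w u → share w u + share u w ≡ 2
  share-sum w u with gives? w u | gives? u w
  ... | yes _ | yes _ = refl
  ... | yes _ | no  _ = refl
  ... | no  _ | yes _ = refl
  ... | no  _ | no  _ = refl

  -- Renaming the two summation variables and adding the result to the original sum puts both shares
  -- of every edge into one term. This doubles both sides, whence the cancellation of 2.
  ∑-receive : ∑ vs receive ≡ degreeSum H
  ∑-receive = *-cancelˡ-≡ _ _ 2 (begin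
    2 * S                                            ≡⟨ cong (S +_) (+-identityʳ S) ⟩
    S + S                                            ≡⟨ cong (S +_) reversed ⟩
    S + ∑ vs (λ u → ∑ vs (λ w → e u w * share u w))  ≡⟨ sym (∑-+ vs _ _) ⟩
    ∑ vs (λ u → ∑ vs (λ w → e u w * share w u) + ∑ vs (λ w → e u w * share u w))
      ≡⟨ ∑-cong vs (λ u → trans (sym (∑-+ vs _ _)) (trans (∑-cong vs (both u)) (∑-* vs 2 _))) ⟩
    ∑ vs (λ u → 2 * ∑ vs (e u))                      ≡⟨ ∑-* vs 2 _ ⟩
    2 * degreeSum H                                  ∎)
    where
    open ≡-Reasoning
    e : V → V → ℕ
    e u w = b2n (adj H u w)
    S : ℕ
    S = ∑ vs receive
    reversed : S ≡ ∑ vs (λ u → ∑ vs (λ w → e u w * share u w))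
    reversed = trans (∑-swap vs vs _)
      (∑-cong vs (λ w → ∑-cong vs (λ u → cong (λ b → b2n b * share w u) (Graph.sym H u w))))
    both : ∀ u w → e u w * share w u + e u w * share u w ≡ 2 * e u w
    both u w = trans (sym (*-distribˡ-+ (e u w) (share w u) (share u w)))
      (trans (cong (e u w *_) (share-sum w u)) (*-comm (e u w) 2))

  discharge : (deficit : V → ℕ) → (∀ u → 3 ≤ receive u + deficit u) →
              3 * (k * n) ≤ degreeSum H + ∑ vs deficit
  discharge deficit enough = begin
    3 * (k * n)                       ≡⟨ sym (∑-const 3) ⟩
    ∑ vs (λ _ → 3)                    ≤⟨ ∑-mono vs enough ⟩
    ∑ vs (λ u → receive u + deficit u) ≡⟨ ∑-+ vs receive deficit ⟩
    ∑ vs receive + ∑ vs deficit       ≡⟨ cong (_+ ∑ vs deficit) ∑-receive ⟩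
    degreeSum H + ∑ vs deficit        ∎
    where open ≤-Reasoning

  Receives : ℕ → V → V → Set
  Receives s u w = E H u w × s ≤ share w u

  receives-gift : ∀ {u w} → E H u w → Gives w u → ¬ Gives u w → Receives 2 u w
  receives-gift {u} {w} e gift ¬back = e , gifted (gives? w u) (gives? u w)
    where
    gifted : (d : Dec (Gives w u)) (d′ : Dec (Gives u w)) → 2 ≤ suc ⟦ d ⟧ ∸ ⟦ d′ ⟧
    gifted (yes _)   (no _)     = s≤s (s≤s z≤n)
    gifted (no ¬gift) _         = ⊥-elim (¬gift gift)
    gifted _         (yes back) = ⊥-elim (¬back back)

  receives-own : ∀ {u w} → E H u w → ¬ Gives u w → Receives 1 u w
  receives-own {u} {w} e ¬gives = e , kept (gives? u w)
    where
    kept : (d : Dec (Gives u w)) → 1 ≤ suc ⟦ gives? w u ⟧ ∸ ⟦ d ⟧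
    kept (no _)  = s≤s z≤n
    kept (yes g) = ⊥-elim (¬gives g)

  receives-term : ∀ {s u w} → Receives s u w → s ≤ b2n (adj H u w) * share w u
  receives-term {u = u} {w} (e , s≤) rewrite e | +-identityʳ (share w u) = s≤

  receive-one : ∀ {s u w} → Receives s u w → s ≤ receive u
  receive-one {w = w} rw = ≤-trans (receives-term rw) (∑-one _ w)

  receive-two : ∀ {s t u w x} → w ≢ x → Receives s u w → Receives t u x → s + t ≤ receive u
  receive-two w≢x rw rx =
    ≤-trans (+-mono-≤ (receives-term rw) (receives-term rx)) (∑-two _ w≢x)

  receive-three : ∀ {s t r u w x y} → w ≢ x → w ≢ y → x ≢ y →
    Receives s u w → Receives t u x → Receives r u y → s + t + r ≤ receive u
  receive-three w≢x w≢y x≢y rw rx ry =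
    ≤-trans (+-mono-≤ (+-mono-≤ (receives-term rw) (receives-term rx)) (receives-term ry))
            (∑-three _ w≢x w≢y x≢y)

-- Lower bound: saturation in terms of paths of length three.

module LowerBound {k n : ℕ} (H : Graph (Vtx (suc (suc k)) n)) (sat : C4Saturated H (K (suc (suc k)) n)) where
  open Vertices {suc (suc k)} {n}

  part : V → Fin (suc (suc k))
  part = proj₁

  infix 4 _~_ _~?_
  _~_ : V → V → Set
  _~_ = E H

  _~?_ : ∀ u v → Dec (u ~ v)
  u ~? v = adj H u v Bool.≟ true

  ~-sym : ∀ {u v} → u ~ v → v ~ u
  ~-sym {u} {v} e = trans (Graph.sym H v u) e

  ~⇒part≢ : ∀ {u v} → u ~ v → part u ≢ part v
  ~⇒part≢ {u} {v} e = K⇒part≢ {u} {v} (proj₁ sat u v e)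

  ~⇒≢ : ∀ {u v} → u ~ v → u ≢ v
  ~⇒≢ e refl = ~⇒part≢ e refl

  -- Otherwise `x`, `p`, `y`, `q` is a 4-cycle. The discharging arguments use the absence of
  -- 4-cycles in this form.
  common-unique : ∀ {x y p q} → x ≢ y → x ~ p → p ~ y → x ~ q → q ~ y → p ≡ q
  common-unique {x} {y} {p} {q} x≢y xp py xq qy with p ≟ᵛ q
  ... | yes p≡q = p≡q
  ... | no  p≢q = ⊥-elim (proj₁ (proj₂ sat)
    (x , p , y , q , (~⇒≢ xp , x≢y , ~⇒≢ xq , ~⇒≢ py , p≢q , ~⇒≢ (~-sym qy)) ,
     xp , py , ~-sym qy , ~-sym xq))

  -- Consecutive vertices differ because they are adjacent, so together with `u ≢ v` the two
  -- inequalities make this a genuine path.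
  Path₃ : V → V → Set
  Path₃ u v = ∃₂ λ p q → u ~ p × p ~ q × q ~ v × u ≢ q × p ≢ v

  Path₃-sym : ∀ {u v} → Path₃ u v → Path₃ v u
  Path₃-sym (p , q , up , pq , qv , u≢q , p≢v) =
    q , p , ~-sym qv , ~-sym pq , ~-sym up , p≢v ∘ sym , u≢q ∘ sym

  Plus : V → V → V → V → Set
  Plus = Eplus H

  -- Two edges of a 4-cycle have different sets of ends, so only one is the added edge.
  old-edge : ∀ {u v a b x y} → (a ≡ u × b ≡ v) ⊎ (a ≡ v × b ≡ u) →
             (x ≢ a × x ≢ b) ⊎ (y ≢ a × y ≢ b) → Plus u v x y → x ~ y
  old-edge _ _ (inj₁ e) = e
  old-edge (inj₁ (refl , refl)) (inj₁ (x≢a , _)) (inj₂ (inj₁ (x≡u , _))) = ⊥-elim (x≢a x≡u)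
  old-edge (inj₁ (refl , refl)) (inj₁ (_ , x≢b)) (inj₂ (inj₂ (x≡v , _))) = ⊥-elim (x≢b x≡v)
  old-edge (inj₁ (refl , refl)) (inj₂ (_ , y≢b)) (inj₂ (inj₁ (_ , y≡v))) = ⊥-elim (y≢b y≡v)
  old-edge (inj₁ (refl , refl)) (inj₂ (y≢a , _)) (inj₂ (inj₂ (_ , y≡u))) = ⊥-elim (y≢a y≡u)
  old-edge (inj₂ (refl , refl)) (inj₁ (_ , x≢b)) (inj₂ (inj₁ (x≡u , _))) = ⊥-elim (x≢b x≡u)
  old-edge (inj₂ (refl , refl)) (inj₁ (x≢a , _)) (inj₂ (inj₂ (x≡v , _))) = ⊥-elim (x≢a x≡v)
  old-edge (inj₂ (refl , refl)) (inj₂ (y≢a , _)) (inj₂ (inj₁ (_ , y≡v))) = ⊥-elim (y≢a y≡v)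
  old-edge (inj₂ (refl , refl)) (inj₂ (_ , y≢b)) (inj₂ (inj₂ (_ , y≡u))) = ⊥-elim (y≢b y≡u)

  -- Removing the new edge `ab` from the cycle leaves the path `a`, `d`, `c`, `b`, whose edges are
  -- old by `old-edge`.
  cycle⇒path : ∀ {u v a b c d} → (a ≡ u × b ≡ v) ⊎ (a ≡ v × b ≡ u) →
    a ≢ c → a ≢ d → b ≢ c → b ≢ d → Plus u v b c → Plus u v c d → Plus u v d a → Path₃ u v
  cycle⇒path {u} {v} {a} {b} {c} {d} new a≢c a≢d b≢c b≢d bc cd da = orient new path
    where
    path : Path₃ a b
    path = d , c , ~-sym (old-edge new (inj₁ (a≢d ∘ sym , b≢d ∘ sym)) da) ,
           ~-sym (old-edge new (inj₁ (a≢c ∘ sym , b≢c ∘ sym)) cd) ,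
           ~-sym (old-edge new (inj₂ (a≢c ∘ sym , b≢c ∘ sym)) bc) , a≢c , b≢d ∘ sym
    orient : (a ≡ u × b ≡ v) ⊎ (a ≡ v × b ≡ u) → Path₃ a b → Path₃ u v
    orient (inj₁ (refl , refl)) p = p
    orient (inj₂ (refl , refl)) p = Path₃-sym p

  -- At least one edge of the cycle created by `uv` is new, since `H` has no 4-cycle; rotating the
  -- cycle moves that edge to the front.
  path₃ : ∀ {u v} → part u ≢ part v → ¬ u ~ v → Path₃ u v
  path₃ {u} {v} u≢v ¬uv = from-cycle (proj₂ (proj₂ sat) u v (part≢⇒K {u} {v} u≢v) (Bool.¬-not ¬uv))
    where
    from-cycle : HasC4 (Plus u v) → Path₃ u v
    from-cycle (a , b , c , d , (a≢b , a≢c , a≢d , b≢c , b≢d , c≢d) , inj₁ ab , inj₁ bc , inj₁ cd , inj₁ da) =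
      ⊥-elim (proj₁ (proj₂ sat) (a , b , c , d , (a≢b , a≢c , a≢d , b≢c , b≢d , c≢d) , ab , bc , cd , da))
    from-cycle (a , b , c , d , (a≢b , a≢c , a≢d , b≢c , b≢d , c≢d) , inj₂ ab , bc , cd , da) =
      cycle⇒path ab a≢c a≢d b≢c b≢d bc cd da
    from-cycle (a , b , c , d , (a≢b , a≢c , a≢d , b≢c , b≢d , c≢d) , ab , inj₂ bc , cd , da) =
      cycle⇒path bc b≢d (a≢b ∘ sym) c≢d (a≢c ∘ sym) cd da ab
    from-cycle (a , b , c , d , (a≢b , a≢c , a≢d , b≢c , b≢d , c≢d) , ab , bc , inj₂ cd , da) =
      cycle⇒path cd (a≢c ∘ sym) (b≢c ∘ sym) (a≢d ∘ sym) (b≢d ∘ sym) da ab bc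
    from-cycle (a , b , c , d , (a≢b , a≢c , a≢d , b≢c , b≢d , c≢d) , ab , bc , cd , inj₂ da) =
      cycle⇒path da (b≢d ∘ sym) (c≢d ∘ sym) a≢b a≢c ab bc cd

  -- A vertex of another part, which exists as there are at least two parts, is a neighbour itself
  -- or else the end of a path whose first edge leads to one.
  neighbour : ∀ u → ∃ (u ~_)
  neighbour u with other-part u
    where
    other-part : ∀ u → ∃ λ v → part u ≢ part v
    other-part (zero  , j) = (suc zero , j) , λ ()
    other-part (suc i , j) = (zero , j) , λ ()
  ... | v , u≢v with u ~? v
  ... | yes uv = v , uv
  ... | no ¬uv with path₃ u≢v ¬uv
  ... | p , _ , up , _ = p , up

  -- Lower bound in the presence of a leaf.

  module Leaf (ℓ s : V) (ℓs : ℓ ~ s) (only : ∀ {z} → ℓ ~ z → z ≡ s) where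

    P : Fin (suc (suc k))
    P = part ℓ

    -- The path from `ℓ` to `u` has to begin with `s`. The conclusion also holds for neighbours of
    -- `s`, which therefore lie in a triangle with `s` if they are outside `P`.
    reach : ∀ {u} → part u ≢ P → u ≢ s → ∃ λ w → s ~ w × w ~ u
    reach {u} u∉P u≢s with path₃ (u∉P ∘ sym) (u≢s ∘ only)
    ... | p , q , ℓp , pq , qu , _ rewrite only ℓp = q , pq , qu

    -- The distance from `s`, where `level₃` collects everything beyond distance 2; by `reach` this
    -- occurs only inside `P`.
    data Level (u : V) : ℕ → Set where
      level₀ : u ≡ s → Level u 0
      level₁ : s ~ u → Level u 1
      level₂ : u ≢ s → ¬ s ~ u → (∃ λ w → s ~ w × w ~ u) → Level u 2
      level₃ : u ≢ s → ¬ s ~ u → ¬ (∃ λ w → s ~ w × w ~ u) → Level u 3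

    level : ∀ u → ∃ (Level u)
    level u with u ≟ᵛ s | s ~? u | anyᵛ? (λ w → (s ~? w) ×-dec (w ~? u))
    ... | yes u≡s | _      | _      = 0 , level₀ u≡s
    ... | no u≢s  | yes su | _      = 1 , level₁ su
    ... | no u≢s  | no ¬su | yes w  = 2 , level₂ u≢s ¬su w
    ... | no u≢s  | no ¬su | no ¬w  = 3 , level₃ u≢s ¬su ¬w

    lev : V → ℕ
    lev u = proj₁ (level u)

    lev₀ : lev s ≡ 0
    lev₀ with level s
    ... | _ , level₀ _       = refl
    ... | _ , level₁ ss      = ⊥-elim (~⇒≢ ss refl)
    ... | _ , level₂ s≢s _ _ = ⊥-elim (s≢s refl)
    ... | _ , level₃ s≢s _ _ = ⊥-elim (s≢s refl)

    lev₁ : ∀ {u} → s ~ u → lev u ≡ 1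
    lev₁ {u} su with level u
    ... | _ , level₀ refl    = ⊥-elim (~⇒≢ su refl)
    ... | _ , level₁ _       = refl
    ... | _ , level₂ _ ¬su _ = ⊥-elim (¬su su)
    ... | _ , level₃ _ ¬su _ = ⊥-elim (¬su su)

    lev₂ : ∀ {u} → u ≢ s → ¬ s ~ u → (∃ λ w → s ~ w × w ~ u) → lev u ≡ 2
    lev₂ {u} u≢s ¬su w with level u
    ... | _ , level₀ u≡s     = ⊥-elim (u≢s u≡s)
    ... | _ , level₁ su      = ⊥-elim (¬su su)
    ... | _ , level₂ _ _ _   = refl
    ... | _ , level₃ _ _ ¬w  = ⊥-elim (¬w w)

    lev≤2 : ∀ {u} → part u ≢ P → lev u ≤ 2
    lev≤2 {u} u∉P with level u
    ... | _ , level₀ _         = z≤n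
    ... | _ , level₁ _         = s≤s z≤n
    ... | _ , level₂ _ _ _     = s≤s (s≤s z≤n)
    ... | _ , level₃ u≢s _ ¬w  = ⊥-elim (¬w (reach u∉P u≢s))

    -- For a vertex beyond distance 2 any neighbour will do: the vertex lies in `P`, so the
    -- neighbour does not and is at level at most 2.
    lower-neighbour : ∀ u → u ≢ s → ∃ λ w → u ~ w × lev w < lev u
    lower-neighbour u u≢s with level u
    ... | _ , level₀ u≡s            = ⊥-elim (u≢s u≡s)
    ... | _ , level₁ su             = s , ~-sym su , s≤s (≤-reflexive lev₀)
    ... | _ , level₂ _ _ (w , sw , wu) = w , ~-sym wu , s≤s (≤-reflexive (lev₁ sw))
    ... | _ , level₃ _ _ ¬w with neighbour u
    ... | w , uw = w , uw , s≤s (lev≤2 w∉P)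
      where
      w∉P : part w ≢ P
      w∉P w∈P with part u ≟ P
      ... | yes u∈P = ~⇒part≢ uw (trans u∈P (sym w∈P))
      ... | no  u∉P = ¬w (reach u∉P u≢s)

    -- Every vertex other than `s` gets two units from below. A neighbour on the same level
    -- contributes a third, so outside `P` only these vertices can fall short.
    record Bad (u : V) : Set where
      constructor bad
      field
        outside : part u ≢ P
        no-root : u ≢ s
        alone   : ¬ (∃ λ w → u ~ w × lev w ≡ lev u)
    open Bad

    bad? : Decidable Bad
    bad? u = map′ (λ (o , r , a) → bad o r a) (λ b → outside b , no-root b , alone b)
      (¬? (part u ≟ P) ×-dec ¬? (u ≟ᵛ s) ×-dec ¬? (anyᵛ? λ w → (u ~? w) ×-dec (lev w ℕ.≟ lev u)))

    -- By `reach` a neighbour of `s` outside `P` has a neighbour in common with `s`, and both are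
    -- then at level 1.
    bad⇒¬s~ : ∀ {u} → Bad u → ¬ s ~ u
    bad⇒¬s~ b su with reach (outside b) (no-root b)
    ... | w , sw , wu = alone b (w , ~-sym wu , trans (lev₁ sw) (sym (lev₁ su)))

    bad⇒lev₂ : ∀ {u} → Bad u → lev u ≡ 2
    bad⇒lev₂ b = lev₂ (no-root b) (bad⇒¬s~ b) (reach (outside b) (no-root b))

    bad⇒no-lev₂ : ∀ {u w} → Bad u → u ~ w → lev w ≢ 2
    bad⇒no-lev₂ b uw l = alone b (_ , uw , trans l (sym (bad⇒lev₂ b)))

    -- The path joining two bad vertices of different parts runs through level 1.
    bad-path : ∀ {x y p q} → Bad x → Bad y → x ~ p → p ~ q → q ~ y → s ~ p
    bad-path {x} {y} {p} {q} bx by xp pq qy = decidable-stable (s ~? p) λ ¬sp →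
      bad⇒no-lev₂ by (~-sym qy)
        (lev₂ (λ q≡s → ¬sp (~-sym (subst (p ~_) q≡s pq))) (λ sq → no-parent ¬sp (q , sq , ~-sym pq))
              (reach (q∉P ¬sp) (λ q≡s → ¬sp (~-sym (subst (p ~_) q≡s pq)))))
      where
      p≢s : p ≢ s
      p≢s p≡s = bad⇒¬s~ bx (~-sym (subst (x ~_) p≡s xp))
      no-parent : ¬ s ~ p → ¬ (∃ λ w → s ~ w × w ~ p)
      no-parent ¬sp w = bad⇒no-lev₂ bx xp (lev₂ p≢s ¬sp w)
      q∉P : ¬ s ~ p → part q ≢ P
      q∉P ¬sp q∈P = no-parent ¬sp (reach (λ p∈P → ~⇒part≢ pq (trans p∈P (sym q∈P))) p≢s)

    -- Both vertices are at level 2, hence not adjacent and joined by a path. Applying `bad-path` to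
    -- this path and to its reverse puts both inner vertices next to `s`.
    bad-parents : ∀ {x y} → Bad x → Bad y → part x ≢ part y →
      ∃₂ λ p q → (s ~ p × p ~ x) × (s ~ q × q ~ y) × p ~ q
    bad-parents bx by x≢y =
      let ¬xy = λ xy → bad⇒no-lev₂ bx xy (bad⇒lev₂ by)
          p , q , xp , pq , qy , _ = path₃ x≢y ¬xy
      in p , q , (bad-path bx by xp pq qy , ~-sym xp) ,
         (bad-path by bx (~-sym qy) (~-sym pq) (~-sym xp) , qy) , pq

    parent-unique : ∀ {x p q} → Bad x → s ~ p × p ~ x → s ~ q × q ~ x → p ≡ q
    parent-unique b (sp , px) (sq , qx) = common-unique (no-root b ∘ sym) sp px sq qx

    -- As parents are unique, the three pairs yield the same parents `p`, `q`, `r`, pairwise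
    -- adjacent. Then `p` and `r` are distinct common neighbours of `s` and `q`.
    no-three-bad : ∀ {x y z} → Bad x → Bad y → Bad z →
      part x ≢ part y → part x ≢ part z → part y ≢ part z → ⊥
    no-three-bad bx by bz x≢y x≢z y≢z =
      let p , q , p→x , q→y , pq = bad-parents bx by x≢y
          p′ , r , p′→x , r→z , p′r = bad-parents bx bz x≢z
          q′ , r′ , q′→y , r′→z , q′r′ = bad-parents by bz y≢z
          p′≡p = parent-unique bx p′→x p→x
          qr = subst₂ _~_ (parent-unique by q′→y q→y) (parent-unique bz r′→z r→z) q′r′
          pr = subst (_~ r) p′≡p p′r
      in ~⇒≢ pr (common-unique (~⇒≢ (proj₁ q→y)) (proj₁ p→x) pq (proj₁ r→z) (~-sym qr))

    open Discharging H (λ w u → lev w < lev u) (λ w u → lev w ℕ.<? lev u)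

    receives-below : ∀ {u w} → u ~ w → lev w < lev u → Receives 2 u w
    receives-below uw w<u = receives-gift uw w<u (<-asym w<u)

    receives-level : ∀ {u w} → u ~ w → lev w ≡ lev u → Receives 1 u w
    receives-level uw eq = receives-own uw (<-irrefl (sym eq))

    module _ (Q R : Fin (suc (suc k))) (covers : ∀ {u} → Bad u → part u ≡ Q ⊎ part u ≡ R) where

      covered-bound : 3 * (suc (suc k) * n) ≤ degreeSum H + (3 * n + 3)
      covered-bound = ≤-trans (discharge deficit enough) (≤-reflexive (cong (degreeSum H +_) ∑-deficit))
        where
        inP inQ inR deficit : V → ℕ
        inP u = ⟦ part u ≟ P ⟧
        inQ u = ⟦ part u ≟ Q ⟧
        inR u = ⟦ part u ≟ R ⟧
        -- The root `s` may be left with nothing and needs 3. If some of `P`, `Q`, `R` coincide, the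
        -- charges accumulate and the total is still `3 * n + 3`.
        deficit u = inP u + (inQ u + (inR u + 3 * ⟦ u ≟ᵛ s ⟧))
        ∑-deficit : ∑ vs deficit ≡ 3 * n + 3
        ∑-deficit = trans (trans (∑-+ vs _ _) (cong₂ _+_ (∑-part P)
          (trans (∑-+ vs _ _) (cong₂ _+_ (∑-part Q)
          (trans (∑-+ vs _ _) (cong₂ _+_ (∑-part R) (∑-c*δ 3 s))))))) (regroup n)
          where
          regroup : ∀ n → n + (n + (n + 3)) ≡ 3 * n + 3
          regroup = solve-∀
        P-pays : ∀ {u} → part u ≡ P → 1 ≤ deficit u
        P-pays {u} u∈P = ≤-left (inP u) (1≤⟦ part u ≟ P ⟧ u∈P)
        QR-pay : ∀ {u} → part u ≡ Q ⊎ part u ≡ R → 1 ≤ deficit u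
        QR-pay {u} (inj₁ u∈Q) = ≤-right (inP u) (≤-left (inQ u) (1≤⟦ part u ≟ Q ⟧ u∈Q))
        QR-pay {u} (inj₂ u∈R) = ≤-right (inP u) (≤-right (inQ u) (≤-left (inR u) (1≤⟦ part u ≟ R ⟧ u∈R)))
        s-pays : ∀ {u} → u ≡ s → 3 ≤ deficit u
        s-pays {u} u≡s = ≤-right (inP u) (≤-right (inQ u) (≤-right (inR u) (*-monoʳ-≤ 3 (1≤⟦ u ≟ᵛ s ⟧ u≡s))))
        from-below : ∀ {u} → (∃ λ w → u ~ w × lev w < lev u) →
          Dec (part u ≡ P) → Dec (∃ λ z → u ~ z × lev z ≡ lev u) → u ≢ s → 3 ≤ receive u + deficit u
        from-below (w , uw , w<u) (yes u∈P) _ _ = +-mono-≤ (receive-one (receives-below uw w<u)) (P-pays u∈P)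
        from-below (w , uw , w<u) (no u∉P) (no alone′) u≢s =
          +-mono-≤ (receive-one (receives-below uw w<u)) (QR-pay (covers (bad u∉P u≢s alone′)))
        from-below (w , uw , w<u) (no _) (yes (z , uz , z≡u)) _ =
          ≤-trans (receive-two w≢z (receives-below uw w<u) (receives-level uz z≡u)) (m≤m+n _ _)
          where
          w≢z : w ≢ z
          w≢z refl = <-irrefl z≡u w<u
        enough : ∀ u → 3 ≤ receive u + deficit u
        enough u = [ (λ u≡s → ≤-trans (s-pays u≡s) (m≤n+m _ (receive u)))
                   , (λ u≢s → from-below (lower-neighbour u u≢s) (part u ≟ P)
                                (anyᵛ? λ z → (u ~? z) ×-dec (lev z ℕ.≟ lev u)) u≢s)
                   ]′ (toSum (u ≟ᵛ s))

    bound : 3 * (suc (suc k) * n) ≤ degreeSum H + (3 * n + 3)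
    bound = let Q , R , covers = cover-by-two bad? P no-three-bad in covered-bound Q R covers

  -- Vertices of degree one and two.

  IsLeaf : V → Set
  IsLeaf ℓ = ∃ λ s → ℓ ~ s × (∀ z → ℓ ~ z → z ≡ s)

  isLeaf? : Decidable IsLeaf
  isLeaf? ℓ = anyᵛ? λ s → (ℓ ~? s) ×-dec allᵛ? (λ z → (ℓ ~? z) →-dec (z ≟ᵛ s))

  HasDegree₂ : V → V → V → Set
  HasDegree₂ v a b = a ≢ b × v ~ a × v ~ b × (∀ z → v ~ z → z ≡ a ⊎ z ≡ b)

  Degree₂ : V → Set
  Degree₂ v = ∃₂ (HasDegree₂ v)

  hasDegree₂? : ∀ v a b → Dec (HasDegree₂ v a b)
  hasDegree₂? v a b = ¬? (a ≟ᵛ b) ×-dec (v ~? a) ×-dec (v ~? b) ×-dec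
    allᵛ? (λ z → (v ~? z) →-dec ((z ≟ᵛ a) ⊎-dec (z ≟ᵛ b)))

  degree₂? : Decidable Degree₂
  degree₂? v = anyᵛ? λ a → anyᵛ? λ b → hasDegree₂? v a b

  third-neighbour : ∀ {u a b} → ¬ Degree₂ u → a ≢ b → u ~ a → u ~ b → ∃ λ z → u ~ z × z ≢ a × z ≢ b
  third-neighbour {u} {a} {b} ¬two a≢b ua ub
    with anyᵛ? (λ z → (u ~? z) ×-dec ¬? (z ≟ᵛ a) ×-dec ¬? (z ≟ᵛ b))
  ... | yes third = third
  ... | no ¬third = ⊥-elim (¬two (a , b , a≢b , ua , ub , λ z uz → only z uz (z ≟ᵛ a) (z ≟ᵛ b)))
    where
    only : ∀ z → u ~ z → Dec (z ≡ a) → Dec (z ≡ b) → z ≡ a ⊎ z ≡ b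
    only z uz (yes z≡a) _         = inj₁ z≡a
    only z uz _         (yes z≡b) = inj₂ z≡b
    only z uz (no z≢a)  (no z≢b)  = ⊥-elim (¬third (z , uz , z≢a , z≢b))

  no-three-neighbours : ∀ {v x y z} → Degree₂ v → v ~ x → v ~ y → v ~ z → x ≢ y → x ≢ z → y ≡ z
  no-three-neighbours (a , b , _ , _ , _ , only) vx vy vz x≢y x≢z
    with only _ vx | only _ vy | only _ vz
  ... | inj₁ refl | inj₁ refl | _         = ⊥-elim (x≢y refl)
  ... | inj₁ refl | inj₂ _    | inj₁ refl = ⊥-elim (x≢z refl)
  ... | inj₁ refl | inj₂ refl | inj₂ refl = refl
  ... | inj₂ refl | inj₂ refl | _         = ⊥-elim (x≢y refl)
  ... | inj₂ refl | inj₁ _    | inj₂ refl = ⊥-elim (x≢z refl)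
  ... | inj₂ refl | inj₁ refl | inj₁ refl = refl

  -- Lower bound without leaves.

  module Leafless (no-leaf : ∀ u → ¬ IsLeaf u) where

    second-neighbour : ∀ u s → ∃ λ z → u ~ z × z ≢ s
    second-neighbour u s with anyᵛ? (λ z → (u ~? z) ×-dec ¬? (z ≟ᵛ s))
    ... | yes second = second
    ... | no ¬second = ⊥-elim (no-leaf u (s , subst (u ~_) (only _ uw) uw , only))
      where
      only : ∀ z → u ~ z → z ≡ s
      only z uz = decidable-stable (z ≟ᵛ s) (λ z≢s → ¬second (z , uz , z≢s))
      uw : u ~ proj₁ (neighbour u)
      uw = proj₂ (neighbour u)

    three-neighbours : ∀ {u} → ¬ Degree₂ u →
      ∃ λ x → ∃ λ y → ∃ λ z → (x ≢ y × x ≢ z × y ≢ z) × u ~ x × u ~ y × u ~ z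
    three-neighbours {u} ¬two =
      let x , ux = neighbour u
          y , uy , y≢x = second-neighbour u x
          z , uz , z≢x , z≢y = third-neighbour ¬two (y≢x ∘ sym) ux uy
      in x , y , z , (y≢x ∘ sym , z≢x ∘ sym , z≢y ∘ sym) , ux , uy , uz

    -- Under the empty giving relation every vertex keeps one unit for each of its edges, at least
    -- three in all.
    bound-min-degree₃ : (∀ u → ¬ Degree₂ u) → 3 * (suc (suc k) * n) ≤ degreeSum H + 0
    bound-min-degree₃ ¬two =
      ≤-trans (discharge (λ _ → 0) enough) (≤-reflexive (cong (degreeSum H +_) (∑-zero vs)))
      where
      open Discharging H (λ _ _ → ⊥) (λ _ _ → no λ ())
      enough : ∀ u → 3 ≤ receive u + 0
      enough u =
        let x , y , z , (x≢y , x≢z , y≢z) , ux , uy , uz = three-neighbours (¬two u)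
        in ≤-trans (receive-three x≢y x≢z y≢z (receives-own ux id) (receives-own uy id) (receives-own uz id))
                   (m≤m+n _ _)

    -- Discharging from a vertex of degree two.

    module AtDegree₂ (v a b : V) (v₂ : HasDegree₂ v a b) where

      P : Fin (suc (suc k))
      P = part v

      a≢b : a ≢ b
      a≢b = proj₁ v₂

      va : v ~ a
      va = proj₁ (proj₂ v₂)

      vb : v ~ b
      vb = proj₁ (proj₂ (proj₂ v₂))

      v-only : ∀ {z} → v ~ z → z ≡ a ⊎ z ≡ b
      v-only = proj₂ (proj₂ (proj₂ v₂)) _

      -- As `a` and `b` are the only neighbours of `v`, these are the vertices at distance two from
      -- `v`; `Far` collects those beyond.
      record Second (u : V) : Set where
        constructor second
        field
          ≢v : u ≢ v
          ≢a : u ≢ a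
          ≢b : u ≢ b
          parent : a ~ u ⊎ b ~ u
      open Second

      second? : Decidable Second
      second? u = map′ (λ (p , q , r , s) → second p q r s) (λ w → ≢v w , ≢a w , ≢b w , parent w)
        (¬? (u ≟ᵛ v) ×-dec ¬? (u ≟ᵛ a) ×-dec ¬? (u ≟ᵛ b) ×-dec ((a ~? u) ⊎-dec (b ~? u)))

      record Far (u : V) : Set where
        constructor far
        field
          f≢v : u ≢ v
          f≢a : u ≢ a
          f≢b : u ≢ b
          ¬second : ¬ Second u
      open Far

      far? : Decidable Far
      far? u = map′ (λ (p , q , r , s) → far p q r s) (λ w → f≢v w , f≢a w , f≢b w , ¬second w)
        (¬? (u ≟ᵛ v) ×-dec ¬? (u ≟ᵛ a) ×-dec ¬? (u ≟ᵛ b) ×-dec ¬? (second? u))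

      parent-edge : ∀ {p u} → p ≡ a ⊎ p ≡ b → p ~ u → a ~ u ⊎ b ~ u
      parent-edge (inj₁ refl) = inj₁
      parent-edge (inj₂ refl) = inj₂

      not-both : ∀ {u} → u ≢ v → a ~ u → b ~ u → ⊥
      not-both u≢v au bu = u≢v (common-unique a≢b au (~-sym bu) (~-sym va) vb)

      -- A path of length three from `v` leaves through `a` or `b`. It exists for vertices at
      -- distance two as well, which is what `no-bad-without-triangle` exploits.
      reach : ∀ {u} → part u ≢ P → u ≢ a → u ≢ b →
              ∃₂ λ p q → (p ≡ a ⊎ p ≡ b) × p ~ q × q ~ u × q ≢ v
      reach u∉P u≢a u≢b =
        let p , q , vp , pq , qu , v≢q , _ = path₃ (u∉P ∘ sym) ([ u≢a , u≢b ]′ ∘ v-only)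
        in p , q , v-only vp , pq , qu , v≢q ∘ sym

      -- Far vertices of degree at least three live on their own units, so only those of degree two
      -- are helped.
      Gives : V → V → Set
      Gives w u = ((w ≡ a ⊎ w ≡ b) × Second u) ⊎ (Second w × Far u × Degree₂ u)

      gives? : ∀ w u → Dec (Gives w u)
      gives? w u = (((w ≟ᵛ a) ⊎-dec (w ≟ᵛ b)) ×-dec second? u) ⊎-dec
                   (second? w ×-dec far? u ×-dec degree₂? u)

      open Discharging H Gives gives?

      root-takes-none : ∀ {w u} → u ≡ v ⊎ u ≡ a ⊎ u ≡ b → ¬ Gives w u
      root-takes-none (inj₁ refl)        = [ (λ g → ≢v (proj₂ g) refl) , (λ g → f≢v (proj₁ (proj₂ g)) refl) ]′
      root-takes-none (inj₂ (inj₁ refl)) = [ (λ g → ≢a (proj₂ g) refl) , (λ g → f≢a (proj₁ (proj₂ g)) refl) ]′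
      root-takes-none (inj₂ (inj₂ refl)) = [ (λ g → ≢b (proj₂ g) refl) , (λ g → f≢b (proj₁ (proj₂ g)) refl) ]′

      v-gives-none : ∀ {w} → ¬ Gives v w
      v-gives-none (inj₁ (inj₁ refl , _)) = ~⇒≢ va refl
      v-gives-none (inj₁ (inj₂ refl , _)) = ~⇒≢ vb refl
      v-gives-none (inj₂ (w , _))         = ≢v w refl

      far-gives-none : ∀ {u w} → Far u → ¬ Gives u w
      far-gives-none f (inj₁ (inj₁ u≡a , _)) = f≢a f u≡a
      far-gives-none f (inj₁ (inj₂ u≡b , _)) = f≢b f u≡b
      far-gives-none f (inj₂ (w , _))        = ¬second f w

      second-gives : ∀ {u w} → Second u → Gives u w → Far w × Degree₂ w
      second-gives s (inj₁ (inj₁ u≡a , _)) = ⊥-elim (≢a s u≡a)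
      second-gives s (inj₁ (inj₂ u≡b , _)) = ⊥-elim (≢b s u≡b)
      second-gives s (inj₂ (_ , g))        = g

      v-receives : 2 ≤ receive v
      v-receives = receive-two a≢b (receives-own va v-gives-none) (receives-own vb v-gives-none)

      a-receives-from-v : Receives 1 a v
      a-receives-from-v = receives-own (~-sym va) (root-takes-none (inj₁ refl))

      b-receives-from-v : Receives 1 b v
      b-receives-from-v = receives-own (~-sym vb) (root-takes-none (inj₁ refl))

      -- In degree two, the last vertex `q` before `u` on a path of length three from `v` is a
      -- `Second` vertex and gives: two units from `q`, one from the other neighbour.
      far-receives : ∀ {u} → Far u → part u ≢ P → 3 ≤ receive u
      far-receives {u} f u∉P = by-degree (degree₂? u)
        where
        own : ∀ {w} → u ~ w → Receives 1 u w
        own uw = receives-own uw (far-gives-none f)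
        ¬parent : ∀ {q} → q ~ u → ¬ (q ≡ a ⊎ q ≡ b)
        ¬parent qu qab = ¬second f (second (f≢v f) (f≢a f) (f≢b f) (parent-edge qab qu))
        by-degree : Dec (Degree₂ u) → 3 ≤ receive u
        by-degree (no ¬two) = from-three (three-neighbours ¬two)
          where
          from-three : (∃ λ x → ∃ λ y → ∃ λ z → (x ≢ y × x ≢ z × y ≢ z) × u ~ x × u ~ y × u ~ z) →
                       3 ≤ receive u
          from-three (_ , _ , _ , (x≢y , x≢z , y≢z) , ux , uy , uz) =
            receive-three x≢y x≢z y≢z (own ux) (own uy) (own uz)
        by-degree (yes two) = from-path (reach u∉P (f≢a f) (f≢b f))
          where
          from-path : (∃₂ λ p q → (p ≡ a ⊎ p ≡ b) × p ~ q × q ~ u × q ≢ v) → 3 ≤ receive u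
          from-path (p , q , pab , pq , qu , q≢v) =
            let z , uz , z≢q = second-neighbour u q
                q-second = second q≢v (¬parent qu ∘ inj₁) (¬parent qu ∘ inj₂) (parent-edge pab pq)
            in receive-two (z≢q ∘ sym)
                 (receives-gift (~-sym qu) (inj₂ (q-second , f , two)) (far-gives-none f)) (own uz)

      far-receives₂ : ∀ {u} → Far u → 2 ≤ receive u
      far-receives₂ {u} f =
        let x , ux = neighbour u
            y , uy , y≢x = second-neighbour u x
        in receive-two (y≢x ∘ sym) (receives-own ux (far-gives-none f)) (receives-own uy (far-gives-none f))

      second-from-parent : ∀ {u} → Second u → ∃ λ p → (p ≡ a ⊎ p ≡ b) × Receives 2 u p
      second-from-parent {u} s = from (parent s)
        where
        from : a ~ u ⊎ b ~ u → ∃ λ p → (p ≡ a ⊎ p ≡ b) × Receives 2 u p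
        from (inj₁ au) = a , inj₁ refl , receives-gift (~-sym au) (inj₁ (inj₁ refl , s)) (root-takes-none (inj₂ (inj₁ refl)))
        from (inj₂ bu) = b , inj₂ refl , receives-gift (~-sym bu) (inj₁ (inj₂ refl , s)) (root-takes-none (inj₂ (inj₂ refl)))

      -- The neighbours from which a `Second` vertex cannot expect a unit beyond the two of its
      -- parent: `a` and `b`, and the vertices to which it gives.
      Idle : V → Set
      Idle w = (w ≡ a ⊎ w ≡ b) ⊎ (Far w × Degree₂ w)

      idle? : Decidable Idle
      idle? w = ((w ≟ᵛ a) ⊎-dec (w ≟ᵛ b)) ⊎-dec (far? w ×-dec degree₂? w)

      record Bad (u : V) : Set where
        constructor bad
        field
          isSecond : Second u
          outside  : part u ≢ P
          others   : ∀ w → u ~ w → Idle w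
      open Bad

      bad? : Decidable Bad
      bad? u = map′ (λ (s , p , o) → bad s p o) (λ b → isSecond b , outside b , others b)
        (second? u ×-dec ¬? (part u ≟ P) ×-dec allᵛ? (λ w → (u ~? w) →-dec idle? w))

      second-receives₂ : ∀ {u} → Second u → 2 ≤ receive u
      second-receives₂ s = let _ , _ , from-p = second-from-parent s in receive-one from-p

      second-receives : ∀ {u} → Second u → part u ≢ P → ¬ Bad u → 3 ≤ receive u
      second-receives {u} s u∉P ¬bad =
        let w , ¬o = counterexample (λ w → (u ~? w) →-dec idle? w) (λ o → ¬bad (bad s u∉P o))
            uw = decidable-stable (u ~? w) (λ ¬uw → ¬o (λ uw → ⊥-elim (¬uw uw)))
            p , pab , from-p = second-from-parent s
        in receive-two (λ p≡w → ¬o (λ _ → inj₁ (subst (λ z → z ≡ a ⊎ z ≡ b) p≡w pab)))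
             from-p (receives-own uw (λ g → ¬o (λ _ → inj₂ (second-gives s g))))

      data Kind (u : V) : Set where
        is-v   : u ≡ v → Kind u
        is-a   : u ≡ a → Kind u
        is-b   : u ≡ b → Kind u
        is-second : Second u → Kind u
        is-far : Far u → Kind u

      kind : ∀ u → Kind u
      kind u = classify (u ≟ᵛ v) (u ≟ᵛ a) (u ≟ᵛ b) (second? u)
        where
        classify : Dec (u ≡ v) → Dec (u ≡ a) → Dec (u ≡ b) → Dec (Second u) → Kind u
        classify (yes u≡v) _ _ _ = is-v u≡v
        classify (no _) (yes u≡a) _ _ = is-a u≡a
        classify (no _) (no _) (yes u≡b) _ = is-b u≡b
        classify (no _) (no _) (no _) (yes s) = is-second s
        classify (no u≢v) (no u≢a) (no u≢b) (no ¬s) = is-far (far u≢v u≢a u≢b ¬s)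

      module _ (deficit : V → ℕ) (P-pays : ∀ {u} → part u ≡ P → 1 ≤ deficit u)
               (bad-pays : ∀ {u} → Bad u → 1 ≤ deficit u)
               (a-enough : 3 ≤ receive a + deficit a) (b-enough : 3 ≤ receive b + deficit b) where

        bound-from-deficit : 3 * (suc (suc k) * n) ≤ degreeSum H + ∑ vs deficit
        bound-from-deficit = discharge deficit (λ u → enough (kind u) (part u ≟ P) (bad? u))
          where
          enough : ∀ {u} → Kind u → Dec (part u ≡ P) → Dec (Bad u) → 3 ≤ receive u + deficit u
          enough (is-v refl)   _         _       = +-mono-≤ v-receives (P-pays refl)
          enough (is-a refl)   _         _       = a-enough
          enough (is-b refl)   _         _       = b-enough
          enough (is-far f)    (yes u∈P) _       = +-mono-≤ (far-receives₂ f) (P-pays u∈P)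
          enough (is-far f)    (no u∉P)  _       = ≤-trans (far-receives f u∉P) (m≤m+n _ _)
          enough (is-second s) (yes u∈P) _       = +-mono-≤ (second-receives₂ s) (P-pays u∈P)
          enough (is-second s) (no _)    (yes b) = +-mono-≤ (second-receives₂ s) (bad-pays b)
          enough (is-second s) (no u∉P)  (no ¬b) = ≤-trans (second-receives s u∉P ¬b) (m≤m+n _ _)

      -- On the path `v`, `p`, `q`, `u` the vertex `q` is adjacent to `p`, one of `a` and `b`. So
      -- `q` is not far, and as `a` and `b` are not adjacent it is neither of them; hence `q` is not
      -- idle.
      no-bad-without-triangle : ¬ a ~ b → ∀ {u} → ¬ Bad u
      no-bad-without-triangle ¬ab {u} bu = excluded (others bu q (~-sym qu))
        where
        s = isSecond bu
        path = reach (outside bu) (≢a s) (≢b s)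
        p = proj₁ path
        q = proj₁ (proj₂ path)
        pab : p ≡ a ⊎ p ≡ b
        pab = proj₁ (proj₂ (proj₂ path))
        pq : p ~ q
        pq = proj₁ (proj₂ (proj₂ (proj₂ path)))
        qu : q ~ u
        qu = proj₁ (proj₂ (proj₂ (proj₂ (proj₂ path))))
        independent : ∀ {x y} → x ≡ a ⊎ x ≡ b → y ≡ a ⊎ y ≡ b → ¬ x ~ y
        independent (inj₁ refl) (inj₁ refl) e = ~⇒≢ e refl
        independent (inj₁ refl) (inj₂ refl) e = ¬ab e
        independent (inj₂ refl) (inj₁ refl) e = ¬ab (~-sym e)
        independent (inj₂ refl) (inj₂ refl) e = ~⇒≢ e refl
        excluded : ¬ Idle q
        excluded (inj₁ qab)     = independent pab qab pq
        excluded (inj₂ (f , _)) = ¬second f (second (f≢v f) (f≢a f) (f≢b f) (parent-edge pab pq))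

      bound-without-triangle : ¬ a ~ b → 3 * (suc (suc k) * n) ≤ degreeSum H + (n + 4)
      bound-without-triangle ¬ab = ≤-trans
        (bound-from-deficit deficit P-pays (⊥-elim ∘ no-bad-without-triangle ¬ab) a-enough b-enough)
        (≤-reflexive (cong (degreeSum H +_) ∑-deficit))
        where
        deficit : V → ℕ
        -- The only unit guaranteed to `a` and to `b` comes from `v`, so each is granted 2.
        deficit u = ⟦ part u ≟ P ⟧ + (2 * ⟦ u ≟ᵛ a ⟧ + 2 * ⟦ u ≟ᵛ b ⟧)
        ∑-deficit : ∑ vs deficit ≡ n + 4
        ∑-deficit = trans (∑-+ vs _ _)
          (cong₂ _+_ (∑-part P) (trans (∑-+ vs _ _) (cong₂ _+_ (∑-c*δ 2 a) (∑-c*δ 2 b))))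
        P-pays : ∀ {u} → part u ≡ P → 1 ≤ deficit u
        P-pays {u} u∈P = ≤-left ⟦ part u ≟ P ⟧ (1≤⟦ part u ≟ P ⟧ u∈P)
        a-enough : 3 ≤ receive a + deficit a
        a-enough = +-mono-≤ (receive-one a-receives-from-v) (≤-right ⟦ part a ≟ P ⟧
          (≤-left (2 * ⟦ a ≟ᵛ a ⟧) (*-monoʳ-≤ 2 (1≤⟦ a ≟ᵛ a ⟧ refl))))
        b-enough : 3 ≤ receive b + deficit b
        b-enough = +-mono-≤ (receive-one b-receives-from-v) (≤-right ⟦ part b ≟ P ⟧
          (≤-right (2 * ⟦ b ≟ᵛ a ⟧) (*-monoʳ-≤ 2 (1≤⟦ b ≟ᵛ b ⟧ refl))))

      module Triangle (ab : a ~ b) (triangular : ∀ {u x y} → HasDegree₂ u x y → x ~ y) where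

        same-parent : ∀ {c d u} → c ≡ a ⊎ c ≡ b → d ≡ a ⊎ d ≡ b → u ≢ v → c ~ u → d ~ u → c ≡ d
        same-parent (inj₁ refl) (inj₁ refl) _   _  _  = refl
        same-parent (inj₁ refl) (inj₂ refl) u≢v cu du = ⊥-elim (not-both u≢v cu du)
        same-parent (inj₂ refl) (inj₁ refl) u≢v cu du = ⊥-elim (not-both u≢v du cu)
        same-parent (inj₂ refl) (inj₂ refl) _   _  _  = refl

        -- Two bad children of the same c have no neighbours outside c and the
        -- far vertices of degree 2, so a path between them runs through the latter.
        bad-path : ∀ {c x y p q} → c ≡ a ⊎ c ≡ b → Bad x → Bad y → c ~ x → c ~ y →
                   x ~ p → p ~ q → q ~ y → Degree₂ p
        bad-path {c} {x} {y} {p} {q} cab bx by cx cy xp pq qy = via-p (others bx p xp)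
          where
          via-q : p ≡ a ⊎ p ≡ b → Idle q → ⊥
          via-q pab (inj₂ (f , _)) = ¬second f (second (f≢v f) (f≢a f) (f≢b f) (parent-edge pab pq))
          via-q pab (inj₁ qab)     = ~⇒≢ pq (trans
            (same-parent pab cab (≢v (isSecond bx)) (~-sym xp) cx)
            (same-parent cab qab (≢v (isSecond by)) cy qy))
          via-p : Idle p → Degree₂ p
          via-p (inj₁ pab)       = ⊥-elim (via-q pab (others by q (~-sym qy)))
          via-p (inj₂ (_ , two)) = two

        ends-adjacent : ∀ {p x q} → Degree₂ p → p ~ x → p ~ q → x ≢ q → x ~ q
        ends-adjacent (c , d , p₂@(_ , _ , _ , only)) px pq x≢q = by-ends (only _ px) (only _ pq)
          where
          by-ends : _ ≡ c ⊎ _ ≡ d → _ ≡ c ⊎ _ ≡ d → _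
          by-ends (inj₁ refl) (inj₁ refl) = ⊥-elim (x≢q refl)
          by-ends (inj₁ refl) (inj₂ refl) = triangular p₂
          by-ends (inj₂ refl) (inj₁ refl) = ~-sym (triangular p₂)
          by-ends (inj₂ refl) (inj₂ refl) = ⊥-elim (x≢q refl)

        -- If the parts differ, a path `x`, `p`, `q`, `y` exists, and by `bad-path` in both
        -- directions `p` and `q` have degree two. The neighbours `x` and `q` of `p` are then
        -- adjacent, so `q` has the three neighbours `x`, `p`, `y`, a contradiction.
        bad-same-part : ∀ {c x y} → c ≡ a ⊎ c ≡ b → Bad x × c ~ x → Bad y × c ~ y → part x ≡ part y
        bad-same-part {c} {x} {y} cab (bx , cx) (by , cy) =
          decidable-stable (part x ≟ part y) (λ x≢y → collide x≢y (path₃ x≢y (¬idle ∘ others bx y)))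
          where
          ¬idle : ¬ Idle y
          ¬idle (inj₁ (inj₁ y≡a)) = ≢a (isSecond by) y≡a
          ¬idle (inj₁ (inj₂ y≡b)) = ≢b (isSecond by) y≡b
          ¬idle (inj₂ (f , _))    = ¬second f (isSecond by)
          collide : part x ≢ part y → ¬ Path₃ x y
          collide x≢y (p , q , xp , pq , qy , x≢q , p≢y) =
            p≢y (no-three-neighbours q₂ (~-sym xq) (~-sym pq) qy (~⇒≢ xp) (x≢y ∘ cong part))
            where
            p₂ : Degree₂ p
            p₂ = bad-path cab bx by cx cy xp pq qy
            q₂ : Degree₂ q
            q₂ = bad-path cab by bx cy cx (~-sym qy) (~-sym pq) (~-sym xp)
            xq : x ~ q
            xq = ends-adjacent p₂ (~-sym xp) pq x≢q

        module _ (Q R : Fin (suc (suc k))) (Q-covers : ∀ {u} → Bad u × a ~ u → part u ≡ Q)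
                 (R-covers : ∀ {u} → Bad u × b ~ u → part u ≡ R) where

          covered-bound : 3 * (suc (suc k) * n) ≤ degreeSum H + (3 * n + 2)
          covered-bound = ≤-trans (bound-from-deficit deficit P-pays bad-pays a-enough b-enough)
            (≤-reflexive (cong (degreeSum H +_) ∑-deficit))
            where
            inP inQ inR deficit : V → ℕ
            inP u = ⟦ part u ≟ P ⟧
            inQ u = ⟦ part u ≟ Q ⟧
            inR u = ⟦ part u ≟ R ⟧
            -- Here `a` and `b` also keep their units of the edge `ab`, so one extra unit each is
            -- enough.
            deficit u = inP u + (inQ u + (inR u + (⟦ u ≟ᵛ a ⟧ + ⟦ u ≟ᵛ b ⟧)))
            ∑-deficit : ∑ vs deficit ≡ 3 * n + 2
            ∑-deficit = trans (trans (∑-+ vs _ _) (cong₂ _+_ (∑-part P)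
              (trans (∑-+ vs _ _) (cong₂ _+_ (∑-part Q)
              (trans (∑-+ vs _ _) (cong₂ _+_ (∑-part R)
              (trans (∑-+ vs _ _) (cong₂ _+_ (∑-δ a) (∑-δ b))))))))) (regroup n)
              where
              regroup : ∀ n → n + (n + (n + 2)) ≡ 3 * n + 2
              regroup = solve-∀
            P-pays : ∀ {u} → part u ≡ P → 1 ≤ deficit u
            P-pays {u} u∈P = ≤-left (inP u) (1≤⟦ part u ≟ P ⟧ u∈P)
            bad-pays : ∀ {u} → Bad u → 1 ≤ deficit u
            bad-pays {u} bu = pay (parent (isSecond bu))
              where
              pay : a ~ u ⊎ b ~ u → 1 ≤ deficit u
              pay (inj₁ a~u) = ≤-right (inP u) (≤-left (inQ u) (1≤⟦ part u ≟ Q ⟧ (Q-covers (bu , a~u))))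
              pay (inj₂ b~u) = ≤-right (inP u) (≤-right (inQ u)
                (≤-left (inR u) (1≤⟦ part u ≟ R ⟧ (R-covers (bu , b~u)))))
            ab-pays : ∀ u → 1 ≤ ⟦ u ≟ᵛ a ⟧ + ⟦ u ≟ᵛ b ⟧ → 1 ≤ deficit u
            ab-pays u pays = ≤-right (inP u) (≤-right (inQ u) (≤-right (inR u) pays))
            a-enough : 3 ≤ receive a + deficit a
            a-enough = +-mono-≤
              (receive-two (~⇒≢ vb) a-receives-from-v (receives-own ab (root-takes-none (inj₂ (inj₂ refl)))))
              (ab-pays a (≤-left ⟦ a ≟ᵛ a ⟧ (1≤⟦ a ≟ᵛ a ⟧ refl)))
            b-enough : 3 ≤ receive b + deficit b
            b-enough = +-mono-≤
              (receive-two (~⇒≢ va) b-receives-from-v (receives-own (~-sym ab) (root-takes-none (inj₂ (inj₁ refl)))))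
              (ab-pays b (≤-right ⟦ b ≟ᵛ a ⟧ (1≤⟦ b ≟ᵛ b ⟧ refl)))

        bound-with-triangle : 3 * (suc (suc k) * n) ≤ degreeSum H + (3 * n + 2)
        bound-with-triangle =
          let Q , Q-covers = cover-by-one (λ u → bad? u ×-dec (a ~? u)) P (bad-same-part (inj₁ refl))
              R , R-covers = cover-by-one (λ u → bad? u ×-dec (b ~? u)) P (bad-same-part (inj₂ refl))
          in covered-bound Q R Q-covers R-covers

    Untriangular : V → Set
    Untriangular v = ∃₂ λ a b → HasDegree₂ v a b × ¬ a ~ b

    bound : 1 ≤ n → 3 * (suc (suc k) * n) ≤ degreeSum H + (3 * n + 3)
    bound 1≤n = by-untriangular (anyᵛ? λ v → anyᵛ? λ a → anyᵛ? λ b → hasDegree₂? v a b ×-dec ¬? (a ~? b))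
      where
      by-degree₂ : ¬ ∃ Untriangular → Dec (∃ Degree₂) → 3 * (suc (suc k) * n) ≤ degreeSum H + (3 * n + 3)
      by-degree₂ _ (no ¬two) =
        ≤-trans (bound-min-degree₃ (λ u two → ¬two (u , two))) (+-monoʳ-≤ (degreeSum H) z≤n)
      by-degree₂ ¬untri (yes (v , a , b , v₂)) =
        ≤-trans (AtDegree₂.Triangle.bound-with-triangle v a b v₂ (triangular v₂) triangular)
                (+-monoʳ-≤ (degreeSum H) (+-monoʳ-≤ (3 * n) (n≤1+n 2)))
        where
        triangular : ∀ {u x y} → HasDegree₂ u x y → x ~ y
        triangular {u} {x} {y} u₂ = decidable-stable (x ~? y) (λ ¬xy → ¬untri (u , x , y , u₂ , ¬xy))
      by-untriangular : Dec (∃ Untriangular) → 3 * (suc (suc k) * n) ≤ degreeSum H + (3 * n + 3)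
      by-untriangular (no ¬untri) = by-degree₂ ¬untri (anyᵛ? degree₂?)
      by-untriangular (yes (v , a , b , v₂ , ¬ab)) =
        ≤-trans (AtDegree₂.bound-without-triangle v a b v₂ ¬ab) (+-monoʳ-≤ (degreeSum H) n+4≤3n+3)
        where
        regroup : ∀ n → n + (n + (n + 3)) ≡ 3 * n + 3
        regroup = solve-∀
        n+4≤3n+3 : n + 4 ≤ 3 * n + 3
        -- From `1 ≤ n` follows `4 ≤ n + (n + 3)`.
        n+4≤3n+3 = ≤-trans (+-monoʳ-≤ n (+-mono-≤ 1≤n (m≤n+m 3 n))) (≤-reflexive (regroup n))

  -- From the degree sum to the number of edges.

  degreeSum-bound : 1 ≤ n → 3 * (suc (suc k) * n) ≤ degreeSum H + (3 * n + 3)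
  degreeSum-bound 1≤n = by-leaf (anyᵛ? isLeaf?)
    where
    by-leaf : Dec (∃ IsLeaf) → 3 * (suc (suc k) * n) ≤ degreeSum H + (3 * n + 3)
    by-leaf (yes (ℓ , s , ℓs , only)) = Leaf.bound ℓ s ℓs (only _)
    by-leaf (no ¬leaf)                = Leafless.bound (λ u leaf → ¬leaf (u , leaf)) 1≤n

  -- The degree sum D satisfies `3 * suc k * n ≤ 3 + D`. Subtracting 2 leaves D + 1, and as D is
  -- even the surplus 1 disappears on halving.
  edges-bound : 1 ≤ n → ⌊ (3 * suc k * n ∸ 2) /2⌋ ≤ edges H
  edges-bound 1≤n = begin
    ⌊ (3 * suc k * n ∸ 2) /2⌋    ≤⟨ ⌊n/2⌋-mono (∸-monoˡ-≤ 2 3[k+1]n≤D+3) ⟩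
    ⌊ suc (degreeSum H) /2⌋      ≡⟨ cong (λ d → ⌊ suc d /2⌋) (proj₂ even) ⟩
    ⌊ suc (q + q) /2⌋            ≡⟨ trans (⌊1+q+q/2⌋ q) (sym (⌊q+q/2⌋ q)) ⟩
    ⌊ q + q /2⌋                  ≡⟨ cong ⌊_/2⌋ (sym (proj₂ even)) ⟩
    ⌊ degreeSum H /2⌋            ≡⟨ sym (edges-degreeSum H) ⟩
    edges H                      ∎
    where
    open ≤-Reasoning
    even = degreeSum-even H
    q = proj₁ even
    split : ∀ k n → 3 * (suc (suc k) * n) ≡ 3 * suc k * n + 3 * n
    split = solve-∀
    swap : ∀ d n → d + (3 * n + 3) ≡ 3 + d + 3 * n
    swap = solve-∀
    3[k+1]n≤D+3 : 3 * suc k * n ≤ 3 + degreeSum H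
    3[k+1]n≤D+3 = +-cancelʳ-≤ (3 * n) _ _
      (subst₂ _≤_ (split k n) (swap (degreeSum H) n) (degreeSum-bound 1≤n))

-- Upper bound: saturated cactus graphs.

next : Fin 3 → Fin 3
next zero             = suc zero
next (suc zero)       = suc (suc zero)
next (suc (suc zero)) = zero

-- Consequently the edges from the corners to their hubs form the whole central triangle.
next-related : ∀ i j → i ≢ j → j ≡ next i ⊎ i ≡ next j
next-related = toWitness {a? = all? λ i → all? λ j →
  ¬? (i ≟ j) →-dec ((j ≟ next i) ⊎-dec (i ≟ next j))} _

third : ∀ (i j : Fin 3) → ∃ λ l → i ≢ l × j ≢ l
third = toWitness {a? = all? λ i → all? λ j → any? λ l →
  ¬? (i ≟ l) ×-dec ¬? (j ≟ l)} _

four-in-three : ∀ (i j l m : Fin 3) → i ≡ j ⊎ i ≡ l ⊎ i ≡ m ⊎ j ≡ l ⊎ j ≡ m ⊎ l ≡ m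
four-in-three = toWitness {a? = all? λ i → all? λ j → all? λ l → all? λ m →
  (i ≟ j) ⊎-dec (i ≟ l) ⊎-dec (i ≟ m) ⊎-dec (j ≟ l) ⊎-dec (j ≟ m) ⊎-dec (l ≟ m)} _

-- A central triangle, at whose corners hang pendant triangles (v, mate v, hub v)
-- and leaves (v = mate v); the hub of a corner is the next corner.
module Cactus {k n : ℕ} (cen : Fin 3 → Vtx k n) (φ : Vtx k n → Fin 3) (mate : Vtx k n → Vtx k n)
  (φ-cen : ∀ i → φ (cen i) ≡ next i) (mate-cen : ∀ i → mate (cen i) ≡ cen i)
  (mate-involutive : ∀ v → mate (mate v) ≡ v) (φ-mate : ∀ v → φ (mate v) ≡ φ v)
  (hub-part : ∀ v → proj₁ (cen (φ v)) ≢ proj₁ v)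
  (mate-part : ∀ v → mate v ≢ v → proj₁ (mate v) ≢ proj₁ v)
  (leaf-part : ∀ u v → (∀ i → cen i ≢ u) → (∀ i → cen i ≢ v) → mate u ≡ u → mate v ≡ v →
               φ u ≡ φ v → proj₁ u ≡ proj₁ v) where
  open Vertices {k} {n}

  hub : V → V
  hub v = cen (φ v)

  infix 4 _~_ _~?_
  _~_ : V → V → Set
  x ~ y = y ≡ hub x ⊎ x ≡ hub y ⊎ (y ≡ mate x × x ≢ y)

  _~?_ : ∀ x y → Dec (x ~ y)
  x ~? y = (y ≟ᵛ hub x) ⊎-dec (x ≟ᵛ hub y) ⊎-dec ((y ≟ᵛ mate x) ×-dec ¬? (x ≟ᵛ y))

  ~-sym : ∀ {x y} → x ~ y → y ~ x
  ~-sym (inj₁ e)                      = inj₂ (inj₁ e)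
  ~-sym (inj₂ (inj₁ e))               = inj₁ e
  ~-sym (inj₂ (inj₂ (y≡mx , x≢y))) =
    inj₂ (inj₂ (trans (sym (mate-involutive _)) (cong mate (sym y≡mx)) , x≢y ∘ sym))

  ~⇒part≢ : ∀ {x y} → x ~ y → proj₁ x ≢ proj₁ y
  ~⇒part≢ (inj₁ refl)               = hub-part _ ∘ sym
  ~⇒part≢ (inj₂ (inj₁ refl))        = hub-part _
  ~⇒part≢ (inj₂ (inj₂ (refl , x≢y))) = mate-part _ (x≢y ∘ sym) ∘ sym

  graph : Graph V
  graph = record
    { adj    = λ x y → does (x ~? y)
    ; sym    = λ x y → does-⇔ (mk⇔ ~-sym ~-sym) (x ~? y) (y ~? x)
    ; irrefl = λ x → dec-false (x ~? x) (λ e → ~⇒part≢ e refl)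
    }

  E⇒~ : ∀ {x y} → E graph x y → x ~ y
  E⇒~ {x} {y} = from-does (x ~? y)

  ~⇒E : ∀ {x y} → x ~ y → E graph x y
  ~⇒E {x} {y} = dec-true (x ~? y)

  central? : Decidable (λ v → ∃ λ i → cen i ≡ v)
  central? v = any? (λ i → cen i ≟ᵛ v)

  NonCentral : V → Set
  NonCentral v = ∀ i → cen i ≢ v

  noncentral-neighbour : ∀ {v y} → NonCentral v → v ~ y → y ≡ hub v ⊎ y ≡ mate v
  noncentral-neighbour nc (inj₁ e)              = inj₁ e
  noncentral-neighbour nc (inj₂ (inj₁ e))       = ⊥-elim (nc _ (sym e))
  noncentral-neighbour nc (inj₂ (inj₂ (e , _))) = inj₂ e

  mate-noncentral : ∀ {v} → NonCentral v → NonCentral (mate v)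
  mate-noncentral nc i e = nc i (trans (sym (mate-cen i)) (trans (cong mate e) (mate-involutive _)))

  cen-part : ∀ {i j} → i ≢ j → proj₁ (cen i) ≢ proj₁ (cen j)
  cen-part {i} {j} i≢j with next-related _ _ i≢j
  ... | inj₁ refl = subst (λ l → proj₁ (cen l) ≢ proj₁ (cen i)) (φ-cen i) (hub-part (cen i)) ∘ sym
  ... | inj₂ refl = subst (λ l → proj₁ (cen l) ≢ proj₁ (cen j)) (φ-cen j) (hub-part (cen j))

  cen~cen : ∀ {i j} → i ≢ j → cen i ~ cen j
  cen~cen {i} {j} i≢j with next-related _ _ i≢j
  ... | inj₁ refl = inj₁ (cong cen (sym (φ-cen i)))
  ... | inj₂ refl = inj₂ (inj₁ (cong cen (sym (φ-cen j))))

  -- A cycle through v with neighbours hub v and mate v also has hub v as second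
  -- neighbour of mate v, so it is a triangle.
  cycle-central : ∀ {a b c d} → a ≢ c → b ≢ d → a ~ b → b ~ c → c ~ d → d ~ a → ¬ NonCentral a
  cycle-central {a} {b} {c} {d} a≢c b≢d ab bc cd da nc
    with noncentral-neighbour nc ab | noncentral-neighbour nc (~-sym da)
  ... | inj₁ b≡h | inj₁ d≡h = b≢d (trans b≡h (sym d≡h))
  ... | inj₂ b≡m | inj₂ d≡m = b≢d (trans b≡m (sym d≡m))
  ... | inj₁ b≡h | inj₂ refl = closes b≡h (noncentral-neighbour (mate-noncentral nc) (~-sym cd))
    where
    closes : b ≡ hub a → ¬ (c ≡ hub (mate a) ⊎ c ≡ mate (mate a))
    closes b≡h (inj₁ c≡h) = ~⇒part≢ bc (cong proj₁ (trans b≡h (trans (cong cen (sym (φ-mate a))) (sym c≡h))))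
    closes b≡h (inj₂ c≡a) = a≢c (trans (sym (mate-involutive a)) (sym c≡a))
  ... | inj₂ refl | inj₁ d≡h = closes d≡h (noncentral-neighbour (mate-noncentral nc) bc)
    where
    closes : d ≡ hub a → ¬ (c ≡ hub (mate a) ⊎ c ≡ mate (mate a))
    closes d≡h (inj₁ c≡h) = ~⇒part≢ cd (cong proj₁ (trans c≡h (trans (cong cen (φ-mate a)) (sym d≡h))))
    closes d≡h (inj₂ c≡a) = a≢c (trans (sym (mate-involutive a)) (sym c≡a))

  on-cycle : ∀ {a b c d} → a ≢ c → b ≢ d → a ~ b → b ~ c → c ~ d → d ~ a → ∃ λ i → cen i ≡ a
  on-cycle {a} a≢c b≢d ab bc cd da =
    decidable-stable (central? a) (λ ¬c → cycle-central a≢c b≢d ab bc cd da (λ i e → ¬c (i , e)))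

  -- By `on-cycle` in its four rotations every vertex of a 4-cycle would be a corner, but there are
  -- only three corners.
  C₄-free : ¬ HasC4 (E graph)
  C₄-free (a , b , c , d , (a≢b , a≢c , a≢d , b≢c , b≢d , c≢d) , e₁ , e₂ , e₃ , e₄)
    with E⇒~ e₁ | E⇒~ e₂ | E⇒~ e₃ | E⇒~ e₄
  ... | ab | bc | cd | da
    with on-cycle a≢c b≢d ab bc cd da | on-cycle b≢d (a≢c ∘ sym) bc cd da ab
       | on-cycle (a≢c ∘ sym) (b≢d ∘ sym) cd da ab bc | on-cycle (b≢d ∘ sym) a≢c da ab bc cd
  ... | i , refl | j , refl | l , refl | m , refl with four-in-three i j l m
  ... | inj₁ e                             = a≢b (cong cen e)
  ... | inj₂ (inj₁ e)                      = a≢c (cong cen e)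
  ... | inj₂ (inj₂ (inj₁ e))               = a≢d (cong cen e)
  ... | inj₂ (inj₂ (inj₂ (inj₁ e)))        = b≢c (cong cen e)
  ... | inj₂ (inj₂ (inj₂ (inj₂ (inj₁ e)))) = b≢d (cong cen e)
  ... | inj₂ (inj₂ (inj₂ (inj₂ (inj₂ e)))) = c≢d (cong cen e)

  Path₃ : V → V → Set
  Path₃ u v = ∃₂ λ p q → u ~ p × p ~ q × q ~ v × u ≢ q × p ≢ v

  Path₃-sym : ∀ {u v} → Path₃ u v → Path₃ v u
  Path₃-sym (p , q , up , pq , qv , u≢q , p≢v) =
    q , p , ~-sym qv , ~-sym pq , ~-sym up , p≢v ∘ sym , u≢q ∘ sym

  ~⇒≢ : ∀ {u v} → u ~ v → u ≢ v
  ~⇒≢ e refl = ~⇒part≢ e refl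

  v~hub : ∀ v → v ~ hub v
  v~hub v = inj₁ refl

  via-mate : ∀ {u v} → NonCentral u → NonCentral v → φ u ≡ φ v → mate u ≢ u → ¬ u ~ v → Path₃ u v
  via-mate {u} {v} ncu ncv φ≡ mu≢u ¬uv =
    mate u , hub u , inj₂ (inj₂ (refl , mu≢u ∘ sym)) , inj₁ (cong cen (sym (φ-mate u))) ,
    inj₂ (inj₁ (cong cen φ≡)) , ncu (φ u) ∘ sym ,
    (λ mu≡v → ¬uv (inj₂ (inj₂ (sym mu≡v , λ u≡v → mu≢u (trans mu≡v (sym u≡v))))))

  via-hubs : ∀ {u v} → NonCentral u → NonCentral v → φ u ≢ φ v → Path₃ u v
  via-hubs {u} {v} ncu ncv φ≢ =
    hub u , hub v , v~hub u , cen~cen φ≢ , ~-sym (v~hub v) , ncu (φ v) ∘ sym , ncv (φ u)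

  -- The hub of `v` is a corner other than `cen i`, so it can be reached by the detour over the
  -- third corner.
  from-centre : ∀ {i v} → NonCentral v → ¬ cen i ~ v → Path₃ (cen i) v
  from-centre {i} {v} ncv ¬iv with i ≟ φ v
  ... | yes refl = ⊥-elim (¬iv (~-sym (v~hub v)))
  ... | no i≢φv with third i (φ v)
  ... | l , i≢l , φv≢l = cen l , hub v , cen~cen i≢l , cen~cen (φv≢l ∘ sym) , ~-sym (v~hub v) ,
                         ~⇒≢ (cen~cen i≢φv) , ncv l

  -- Off the corners, different hubs are joined by an edge of the triangle, and at a common hub a
  -- mate of `u` or `v` supplies the extra vertex. If neither has a mate, both are leaves at one
  -- corner, which `leaf-part` puts into the same part.
  path₃ : ∀ u v → proj₁ u ≢ proj₁ v → ¬ u ~ v → Path₃ u v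
  path₃ u v u≢v ¬uv = by-centrality (central? u) (central? v)
    where
    by-mates : NonCentral u → NonCentral v → Dec (φ u ≡ φ v) → Dec (mate u ≡ u) → Dec (mate v ≡ v) → Path₃ u v
    by-mates ncu ncv (no φ≢)  _ _ = via-hubs ncu ncv φ≢
    by-mates ncu ncv (yes φ≡) (no mu≢u) _ = via-mate ncu ncv φ≡ mu≢u ¬uv
    by-mates ncu ncv (yes φ≡) (yes _) (no mv≢v) = Path₃-sym (via-mate ncv ncu (sym φ≡) mv≢v (¬uv ∘ ~-sym))
    by-mates ncu ncv (yes φ≡) (yes mu≡u) (yes mv≡v) = ⊥-elim (u≢v (leaf-part u v ncu ncv mu≡u mv≡v φ≡))
    by-centrality : Dec (∃ λ i → cen i ≡ u) → Dec (∃ λ i → cen i ≡ v) → Path₃ u v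
    by-centrality (yes (i , refl)) (yes (j , refl)) = ⊥-elim (¬uv (cen~cen (u≢v ∘ cong (proj₁ ∘ cen))))
    by-centrality (yes (i , refl)) (no ¬cv) = from-centre (λ j e → ¬cv (j , e)) ¬uv
    by-centrality (no ¬cu) (yes (j , refl)) = Path₃-sym (from-centre (λ i e → ¬cu (i , e)) (¬uv ∘ ~-sym))
    by-centrality (no ¬cu) (no ¬cv) = by-mates (λ i e → ¬cu (i , e)) (λ j e → ¬cv (j , e))
                                        (φ u ≟ φ v) (mate u ≟ᵛ u) (mate v ≟ᵛ v)

  saturated : C4Saturated graph (K k n)
  saturated = within , C₄-free , λ u v kuv ¬uv → 
      close (path₃ u v (K⇒part≢ {u} {v} kuv) (¬E⇒¬~ ¬uv)) (K⇒part≢ {u} {v} kuv)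
    where
    within : graph ⊆G K k n
    within x y e = part≢⇒K {x} {y} (~⇒part≢ (E⇒~ e))
    ¬E⇒¬~ : ∀ {u v} → adj graph u v ≡ false → ¬ u ~ v
    ¬E⇒¬~ ¬uv uv = Bool.not-¬ ¬uv (~⇒E uv)
    close : ∀ {u v} → Path₃ u v → proj₁ u ≢ proj₁ v → HasC4 (Eplus graph u v)
    close {u} {v} (p , q , up , pq , qv , u≢q , p≢v) u≢v =
      u , p , q , v , (~⇒≢ up , u≢q , u≢v ∘ cong proj₁ , ~⇒≢ pq , p≢v , ~⇒≢ qv) ,
      inj₁ (~⇒E up) , inj₁ (~⇒E pq) , inj₁ (~⇒E qv) , inj₂ (inj₂ (refl , refl))

  matched : V → ℕ
  matched v = ⟦ ¬? (mate v ≟ᵛ v) ⟧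

  -- The edge from a vertex to its hub counts twice, once at each end, which gives `2 * (k * n)`; a
  -- matched vertex has its mate as one further neighbour.
  degreeSum≤ : degreeSum graph ≤ 2 * (k * n) + ∑ vs matched
  degreeSum≤ = begin
    degreeSum graph
      ≤⟨ ∑-mono vs (λ x → ∑-mono vs (edge x)) ⟩
    ∑ vs (λ x → ∑ vs (λ y → ⟦ y ≟ᵛ hub x ⟧ + (⟦ x ≟ᵛ hub y ⟧ + matched x * ⟦ y ≟ᵛ mate x ⟧)))
      ≡⟨ ∑-cong vs (λ x → trans (∑-+ vs _ _) (cong₂ _+_ (∑-δ (hub x))
           (trans (∑-+ vs _ _) (cong (∑ vs (λ y → ⟦ x ≟ᵛ hub y ⟧) +_) (∑-c*δ (matched x) (mate x)))))) ⟩
    ∑ vs (λ x → 1 + (∑ vs (λ y → ⟦ x ≟ᵛ hub y ⟧) + matched x))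
      ≡⟨ trans (∑-+ vs _ _) (cong₂ _+_ (∑-const 1) (∑-+ vs _ _)) ⟩
    1 * (k * n) + (∑ vs (λ x → ∑ vs (λ y → ⟦ x ≟ᵛ hub y ⟧)) + ∑ vs matched)
      ≡⟨ cong (λ s → 1 * (k * n) + (s + ∑ vs matched))
           (trans (∑-swap vs vs _) (trans (∑-cong vs (∑-δ ∘ hub)) (∑-const 1))) ⟩
    1 * (k * n) + (1 * (k * n) + ∑ vs matched)
      ≡⟨ regroup (k * n) (∑ vs matched) ⟩
    2 * (k * n) + ∑ vs matched ∎
    where
    open ≤-Reasoning
    regroup : ∀ a s → 1 * a + (1 * a + s) ≡ 2 * a + s
    regroup = solve-∀
    edge : ∀ x y → b2n (adj graph x y) ≤ ⟦ y ≟ᵛ hub x ⟧ + (⟦ x ≟ᵛ hub y ⟧ + matched x * ⟦ y ≟ᵛ mate x ⟧)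
    edge x y with y ≟ᵛ hub x | x ≟ᵛ hub y | y ≟ᵛ mate x | x ≟ᵛ y | mate x ≟ᵛ x
    ... | yes _ | _     | _        | _      | _        = s≤s z≤n
    ... | no _  | yes _ | _        | _      | _        = s≤s z≤n
    ... | no _  | no _  | no _     | _      | _        = z≤n
    ... | no _  | no _  | yes _    | yes _  | _        = z≤n
    ... | no _  | no _  | yes _    | no _   | no _     = s≤s z≤n
    ... | no _  | no _  | yes y≡mx | no x≢y | yes mx≡x = ⊥-elim (x≢y (sym (trans y≡mx mx≡x)))

-- Pairing off consecutive positions.

swap : ∀ d {m} → Fin (d + m) → Fin (d + m)
swap zero {suc zero}    zero          = zero
swap zero {suc (suc m)} zero          = suc zero
swap zero {suc (suc m)} (suc zero)    = zero
swap zero {suc (suc m)} (suc (suc x)) = suc (suc (swap zero x))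
swap (suc d)            zero          = zero
swap (suc d)            (suc x)       = suc (swap d x)

swap-involutive : ∀ d {m} (x : Fin (d + m)) → swap d (swap d x) ≡ x
swap-involutive zero {suc zero}    zero          = refl
swap-involutive zero {suc (suc m)} zero          = refl
swap-involutive zero {suc (suc m)} (suc zero)    = refl
swap-involutive zero {suc (suc m)} (suc (suc x)) = cong (λ y → suc (suc y)) (swap-involutive zero x)
swap-involutive (suc d)            zero          = refl
swap-involutive (suc d)            (suc x)       = cong suc (swap-involutive d x)

Consecutive : ∀ {m} → Fin m → Fin m → Set
Consecutive x y = toℕ y ≡ suc (toℕ x) ⊎ toℕ x ≡ suc (toℕ y)

consecutive-suc : ∀ {m} {x y : Fin m} → Consecutive x y → Consecutive (suc x) (suc y)
consecutive-suc = [ inj₁ ∘ cong suc , inj₂ ∘ cong suc ]′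

swap-consecutive : ∀ d {m} (x : Fin (d + m)) → swap d x ≢ x → Consecutive x (swap d x)
swap-consecutive zero {suc zero}    zero          ≢ = ⊥-elim (≢ refl)
swap-consecutive zero {suc (suc m)} zero          ≢ = inj₁ refl
swap-consecutive zero {suc (suc m)} (suc zero)    ≢ = inj₂ refl
swap-consecutive zero {suc (suc m)} (suc (suc x)) ≢ =
  consecutive-suc (consecutive-suc (swap-consecutive zero x (≢ ∘ cong λ y → suc (suc y))))
swap-consecutive (suc d)            zero          ≢ = ⊥-elim (≢ refl)
swap-consecutive (suc d)            (suc x)       ≢ = consecutive-suc (swap-consecutive d x (≢ ∘ cong suc))

-- Applied to the positions after the corners: if their number is even, nobody in the core is left
-- without a mate except the corners.
swap-fixed-point-free : ∀ {m} → parity m ≡ 0ℙ → (x : Fin m) → swap 0 x ≢ x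
swap-fixed-point-free {suc (suc m)} even (suc (suc x)) eq =
  swap-fixed-point-free even x (suc-injective (suc-injective eq))
swap-fixed-point-free {suc zero}    ()
swap-fixed-point-free {suc (suc m)} even zero ()
swap-fixed-point-free {suc (suc m)} even (suc zero) ()

-- Distributing leaves and pendant triangles over the parts.

-- The vertices of the outer parts are leaves (or a corner); those of the core parts
-- are numbered row by row, so that consecutive ones lie in different parts.
module Grid {k n m : ℕ} (role : Fin k → Fin 3 ⊎ Fin (suc (suc m))) (part : Fin 3 ⊎ Fin (suc (suc m)) → Fin k)
  (part-role : ∀ i → part (role i) ≡ i) (role-core : ∀ c → role (part (inj₂ c)) ≡ inj₂ c) where
  open Vertices {k} {n}

  Pos : Set
  Pos = Fin (n * suc (suc m))

  column : Pos → Fin (suc (suc m))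
  column q = proj₂ (remQuot {n} (suc (suc m)) q)

  row : Pos → Fin n
  row q = proj₁ (remQuot {n} (suc (suc m)) q)

  at : Pos → V
  at q = part (inj₂ (column q)) , row q

  place : V → (Fin 3 × Fin n) ⊎ Pos
  place (i , j) with role i
  ... | inj₁ o = inj₁ (o , j)
  ... | inj₂ c = inj₂ (combine j c)

  data View : V → Set where
    outer : ∀ {i o} j → role i ≡ inj₁ o → View (i , j)
    core  : ∀ q → View (at q)

  view : ∀ v → View v
  view (i , j) with role i in eq
  ... | inj₁ o = outer j eq
  ... | inj₂ c = subst View at-combine (core (combine j c))
    where
    at-combine : at (combine j c) ≡ (i , j)
    at-combine = trans (cong (λ (r , d) → part (inj₂ d) , r) (remQuot-combine j c))
                       (cong (_, j) (trans (cong part (sym eq)) (part-role i)))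

  place-outer : ∀ {i o} j → role i ≡ inj₁ o → place (i , j) ≡ inj₁ (o , j)
  place-outer {i} j eq with role i
  place-outer j refl | inj₁ _ = refl

  place-at : ∀ q → place (at q) ≡ inj₂ q
  place-at q with role (part (inj₂ (column q))) | role-core (column q)
  ... | inj₂ _ | refl = cong inj₂ (combine-remQuot {n} (suc (suc m)) q)

  -- Numbers in the same column differ by a multiple of the row length `suc (suc m)`; if they were
  -- consecutive, this length would divide 1.
  column-consecutive : ∀ {p q : Pos} → Consecutive p q → column p ≢ column q
  column-consecutive = [ distinct , (λ e → distinct e ∘ sym) ]′
    where
    number : ∀ q → suc (suc m) * toℕ (row q) + toℕ (column q) ≡ toℕ q
    number q = trans (sym (toℕ-combine (row q) (column q))) (cong toℕ (combine-remQuot {n} (suc (suc m)) q))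
    no-step : ∀ r s c → suc (suc m) * r + c ≢ suc (suc (suc m) * s + c)
    no-step r s c eq with ∣1⇒≡1 (∣m+n∣m⇒∣n (divides r step) (m∣m*n s))
      where
      step : suc (suc m) * s + 1 ≡ r * suc (suc m)
      step = trans (+-comm _ 1) (trans (sym (+-cancelʳ-≡ c _ _ eq)) (*-comm (suc (suc m)) r))
    ... | ()
    distinct : ∀ {p q} → toℕ q ≡ suc (toℕ p) → column p ≢ column q
    distinct {p} {q} step same = no-step (toℕ (row q)) (toℕ (row p)) (toℕ (column q))
      (trans (number q) (trans step (cong suc (trans (sym (number p))
        (cong (λ c → suc (suc m) * toℕ (row p) + toℕ c) same)))))

  core-part≢ : ∀ {c d} → c ≢ d → part (inj₂ c) ≢ part (inj₂ d)
  core-part≢ {c} {d} c≢d eq =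
    c≢d (inj₂-injective (trans (sym (role-core c)) (trans (cong role eq) (role-core d))))

  outer≢core : ∀ {i o c} → role i ≡ inj₁ o → i ≢ part (inj₂ c)
  outer≢core {c = c} ro refl with trans (sym ro) (role-core c)
  ... | ()

  isOuter : Fin k → ℕ
  isOuter i = [ (λ _ → 1) , (λ _ → 0) ]′ (role i)

  -- `σ-central` confines the leaves to the outer parts, and `φₒ-injective` makes different outer
  -- parts hang at different corners, so the leaves at one corner share a part.
  module Construction (cen : Fin 3 → V) (φₒ : Fin 3 → Fin 3) (φᶜ : Pos → Fin 3) (σ : Pos → Pos)
    (σ-involutive : ∀ q → σ (σ q) ≡ q) (σ-consecutive : ∀ q → σ q ≢ q → Consecutive q (σ q))
    (σ-central : ∀ q → σ q ≡ q → ∃ λ i → cen i ≡ at q) (φᶜ-σ : ∀ q → φᶜ (σ q) ≡ φᶜ q)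
    (φₒ-injective : ∀ o o′ → φₒ o ≡ φₒ o′ → o ≡ o′)
    (φ-cen : ∀ i → [ φₒ ∘ proj₁ , φᶜ ]′ (place (cen i)) ≡ next i)
    (cen-fixed : ∀ i q → place (cen i) ≡ inj₂ q → σ q ≡ q)
    (outer-hub : ∀ {i o} → role i ≡ inj₁ o → proj₁ (cen (φₒ o)) ≢ i)
    (core-hub : ∀ q → proj₁ (cen (φᶜ q)) ≢ part (inj₂ (column q))) where

    φ : V → Fin 3
    φ v = [ φₒ ∘ proj₁ , φᶜ ]′ (place v)

    mate : V → V
    mate v = [ (λ _ → v) , at ∘ σ ]′ (place v)

    φ-outer : ∀ {i o} j → role i ≡ inj₁ o → φ (i , j) ≡ φₒ o
    φ-outer j eq = cong [ φₒ ∘ proj₁ , φᶜ ]′ (place-outer j eq)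

    φ-at : ∀ q → φ (at q) ≡ φᶜ q
    φ-at q = cong [ φₒ ∘ proj₁ , φᶜ ]′ (place-at q)

    mate-outer : ∀ {i o} j → role i ≡ inj₁ o → mate (i , j) ≡ (i , j)
    mate-outer j eq = cong [ (λ _ → _) , at ∘ σ ]′ (place-outer j eq)

    mate-at : ∀ q → mate (at q) ≡ at (σ q)
    mate-at q = cong [ (λ _ → at q) , at ∘ σ ]′ (place-at q)

    at-injective : ∀ {p q} → at p ≡ at q → p ≡ q
    at-injective {p} {q} eq = inj₂-injective (trans (sym (place-at p)) (trans (cong place eq) (place-at q)))

    mate-cen : ∀ i → mate (cen i) ≡ cen i
    mate-cen i = by-view (view (cen i)) (cen-fixed i)
      where
      by-view : ∀ {v} → View v → (∀ q → place v ≡ inj₂ q → σ q ≡ q) → mate v ≡ v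
      by-view (outer j eq) _     = mate-outer j eq
      by-view (core q)     fixed = trans (mate-at q) (cong at (fixed q (place-at q)))

    mate-involutive : ∀ v → mate (mate v) ≡ v
    mate-involutive v = by-view (view v)
      where
      by-view : ∀ {v} → View v → mate (mate v) ≡ v
      by-view (outer j eq) = trans (cong mate (mate-outer j eq)) (mate-outer j eq)
      by-view (core q)     = trans (cong mate (mate-at q)) (trans (mate-at (σ q)) (cong at (σ-involutive q)))

    φ-mate : ∀ v → φ (mate v) ≡ φ v
    φ-mate v = by-view (view v)
      where
      by-view : ∀ {v} → View v → φ (mate v) ≡ φ v
      by-view (outer j eq) = cong φ (mate-outer j eq)
      by-view (core q)     = trans (cong φ (mate-at q)) (trans (φ-at (σ q)) (trans (φᶜ-σ q) (sym (φ-at q))))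

    hub-part : ∀ v → proj₁ (cen (φ v)) ≢ proj₁ v
    hub-part v = by-view (view v)
      where
      by-view : ∀ {v} → View v → proj₁ (cen (φ v)) ≢ proj₁ v
      by-view (outer {i} j eq) = subst (λ l → proj₁ (cen l) ≢ i) (sym (φ-outer j eq)) (outer-hub eq)
      by-view (core q) = subst (λ l → proj₁ (cen l) ≢ proj₁ (at q)) (sym (φ-at q)) (core-hub q)

    mate-part : ∀ v → mate v ≢ v → proj₁ (mate v) ≢ proj₁ v
    mate-part v = by-view (view v)
      where
      by-view : ∀ {v} → View v → mate v ≢ v → proj₁ (mate v) ≢ proj₁ v
      by-view (outer j eq) moved = ⊥-elim (moved (mate-outer j eq))
      by-view (core q)     moved = subst (λ w → proj₁ w ≢ proj₁ (at q)) (sym (mate-at q))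
        (core-part≢ (column-consecutive (σ-consecutive q (λ fixed → moved (trans (mate-at q) (cong at fixed))))
                       ∘ sym))

    leaf-part : ∀ u v → (∀ i → cen i ≢ u) → (∀ i → cen i ≢ v) → mate u ≡ u → mate v ≡ v →
                φ u ≡ φ v → proj₁ u ≡ proj₁ v
    leaf-part u v = by-view (view u) (view v)
      where
      moved : ∀ q → (∀ i → cen i ≢ at q) → mate (at q) ≢ at q
      moved q nc fixed = let i , c = σ-central q (at-injective (trans (sym (mate-at q)) fixed)) in nc i c
      by-view : ∀ {u v} → View u → View v → (∀ i → cen i ≢ u) → (∀ i → cen i ≢ v) →
                mate u ≡ u → mate v ≡ v → φ u ≡ φ v → proj₁ u ≡ proj₁ v
      by-view (core q) _ ncu _ mu _ _ = ⊥-elim (moved q ncu mu)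
      by-view _ (core q) _ ncv _ mv _ = ⊥-elim (moved q ncv mv)
      by-view (outer {i} {o} j ri) (outer {i′} {o′} j′ ri′) _ _ _ _ φ≡ = begin
        i               ≡⟨ sym (part-role i) ⟩
        part (role i)   ≡⟨ cong part ri ⟩
        part (inj₁ o)   ≡⟨ cong (part ∘ inj₁) (φₒ-injective o o′ (trans (sym (φ-outer j ri)) (trans φ≡ (φ-outer j′ ri′)))) ⟩
        part (inj₁ o′)  ≡⟨ cong part (sym ri′) ⟩
        part (role i′)  ≡⟨ part-role i′ ⟩
        i′              ∎
        where open ≡-Reasoning

    open Cactus cen φ mate φ-cen mate-cen mate-involutive φ-mate hub-part mate-part leaf-part public
      using (graph; saturated; degreeSum≤; matched)

    -- The matched vertices, the `l` outer parts and the two fixed core vertices are pairwise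
    -- disjoint, so their indicators add up to at most 1 at each vertex.
    matched≤ : ∀ {p q l} → p ≢ q → σ p ≡ p → σ q ≡ q → ∑ (allFin k) isOuter ≡ l →
               ∑ vs matched + (n * l + 2) ≤ k * n
    matched≤ {p} {q} {l} p≢q σp σq outer-count = begin
      ∑ vs matched + (n * l + 2)
        ≡⟨ cong (∑ vs matched +_) (cong₂ _+_ (sym outer-sum) (cong₂ _+_ (sym (∑-δ (at p))) (sym (∑-δ (at q))))) ⟩
      ∑ vs matched + (∑ vs (isOuter ∘ proj₁) + (∑ vs (λ v → ⟦ v ≟ᵛ at p ⟧) + ∑ vs (λ v → ⟦ v ≟ᵛ at q ⟧)))
        ≡⟨ sym (trans (∑-+ vs _ _) (cong (∑ vs matched +_) (trans (∑-+ vs _ _)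
             (cong (∑ vs (isOuter ∘ proj₁) +_) (∑-+ vs _ _))))) ⟩
      ∑ vs (λ v → matched v + (isOuter (proj₁ v) + (⟦ v ≟ᵛ at p ⟧ + ⟦ v ≟ᵛ at q ⟧)))
        ≤⟨ ∑-mono vs (λ v → at-most-one (view v)) ⟩
      ∑ vs (λ _ → 1)
        ≡⟨ ∑-const 1 ⟩
      1 * (k * n)
        ≡⟨ *-identityˡ (k * n) ⟩
      k * n ∎
      where
      open ≤-Reasoning
      outer-sum : ∑ vs (isOuter ∘ proj₁) ≡ n * l
      outer-sum = trans (∑-vertices _) (trans (∑-cong (allFin k) (λ i → ∑-allFin-const n (isOuter i)))
        (trans (∑-* (allFin k) n isOuter) (cong (n *_) outer-count)))
      matched-fixed : ∀ v → mate v ≡ v → matched v ≡ 0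
      matched-fixed v fixed = cong b2n (dec-false (¬? (mate v ≟ᵛ v)) (λ moved → moved fixed))
      isOuter-outer : ∀ {i o} → role i ≡ inj₁ o → isOuter i ≡ 1
      isOuter-outer eq = cong [ (λ _ → 1) , (λ _ → 0) ]′ eq
      isOuter-core : ∀ c → isOuter (part (inj₂ c)) ≡ 0
      isOuter-core c = cong [ (λ _ → 1) , (λ _ → 0) ]′ (role-core c)
      not-at : ∀ {v r} → v ≢ at r → ⟦ v ≟ᵛ at r ⟧ ≡ 0
      not-at {v} {r} ≢ = cong b2n (dec-false (v ≟ᵛ at r) ≢)
      is-at : ∀ {v r} → v ≡ at r → ⟦ v ≟ᵛ at r ⟧ ≡ 1
      is-at {v} {r} ≡ = cong b2n (dec-true (v ≟ᵛ at r) ≡)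
      b2n≤1 : ∀ b → b2n b ≤ 1
      b2n≤1 true  = ≤-refl
      b2n≤1 false = z≤n
      sum≤1 : ∀ {a b c d} a′ b′ c′ d′ → a ≡ a′ → b ≡ b′ → c ≡ c′ → d ≡ d′ →
              a′ + (b′ + (c′ + d′)) ≤ 1 → a + (b + (c + d)) ≤ 1
      sum≤1 _ _ _ _ refl refl refl refl le = le
      at-most-one : ∀ {v} → View v → matched v + (isOuter (proj₁ v) + (⟦ v ≟ᵛ at p ⟧ + ⟦ v ≟ᵛ at q ⟧)) ≤ 1
      at-most-one (outer {i} j ri) = sum≤1 0 1 0 0
        (matched-fixed (i , j) (mate-outer j ri)) (isOuter-outer ri)
        (not-at (outer≢core ri ∘ cong proj₁)) (not-at (outer≢core ri ∘ cong proj₁)) ≤-refl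
      at-most-one (core r) = by-position (r ≟ p) (r ≟ q)
        where
        fixed : σ r ≡ r → matched (at r) ≡ 0
        fixed e = matched-fixed (at r) (trans (mate-at r) (cong at e))
        by-position : Dec (r ≡ p) → Dec (r ≡ q) →
          matched (at r) + (isOuter (proj₁ (at r)) + (⟦ at r ≟ᵛ at p ⟧ + ⟦ at r ≟ᵛ at q ⟧)) ≤ 1
        by-position (yes refl) (yes refl) = ⊥-elim (p≢q refl)
        by-position (yes refl) (no r≢q) = sum≤1 0 0 1 0 (fixed σp) (isOuter-core (column r))
          (is-at refl) (not-at (r≢q ∘ at-injective)) ≤-refl
        by-position (no r≢p) (yes refl) = sum≤1 0 0 0 1 (fixed σq) (isOuter-core (column r))
          (not-at (r≢p ∘ at-injective)) (is-at refl) ≤-refl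
        by-position (no r≢p) (no r≢q) = sum≤1 (matched (at r)) 0 0 0 refl (isOuter-core (column r))
          (not-at (r≢p ∘ at-injective)) (not-at (r≢q ∘ at-injective))
          (≤-trans (≤-reflexive (+-identityʳ _)) (b2n≤1 _))

    degreeSum-bound : ∀ {p q l} → p ≢ q → σ p ≡ p → σ q ≡ q → ∑ (allFin k) isOuter ≡ l →
                      degreeSum graph + (n * l + 2) ≤ 3 * (k * n)
    degreeSum-bound {l = l} p≢q σp σq outer-count = begin
      degreeSum graph + (n * l + 2)                   ≤⟨ +-monoˡ-≤ (n * l + 2) degreeSum≤ ⟩
      2 * (k * n) + ∑ vs matched + (n * l + 2)        ≡⟨ +-assoc (2 * (k * n)) _ _ ⟩
      2 * (k * n) + (∑ vs matched + (n * l + 2))      ≤⟨ +-monoʳ-≤ (2 * (k * n)) (matched≤ p≢q σp σq outer-count) ⟩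
      2 * (k * n) + k * n                             ≡⟨ regroup (k * n) ⟩
      3 * (k * n)                                     ∎
      where
      open ≤-Reasoning
      regroup : ∀ a → 2 * a + a ≡ 3 * a
      regroup = solve-∀

-- A core with an even number of vertices.

next-injective : ∀ o o′ → next o ≡ next o′ → o ≡ o′
next-injective = toWitness {a? = all? λ o → all? λ o′ → (next o ≟ next o′) →-dec (o ≟ o′)} _

-- The corner lying in the first outer part lowers the number of leaves by one.
module EvenCore {k n m : ℕ} (role : Fin k → Fin 3 ⊎ Fin (suc (suc m))) (part : Fin 3 ⊎ Fin (suc (suc m)) → Fin k)
  (part-role : ∀ i → part (role i) ≡ i) (role-core : ∀ c → role (part (inj₂ c)) ≡ inj₂ c)
  (role-first : role (part (inj₁ zero)) ≡ inj₁ zero) (even : parity (m + n * suc (suc m)) ≡ 0ℙ) where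
  open Vertices {k} {suc n}
  open Grid {k} {suc n} {m} role part part-role role-core

  cen : Fin 3 → V
  cen zero             = part (inj₁ zero) , zero
  cen (suc zero)       = at zero
  cen (suc (suc zero)) = at (suc zero)

  -- All pairs hang at the corner outside the core, whose part they cannot meet. The values at the
  -- first two positions are dictated by the triangle.
  φᶜ : Pos → Fin 3
  φᶜ zero    = suc (suc zero)
  φᶜ (suc _) = zero

  φᶜ-swap : ∀ q → φᶜ (swap 2 q) ≡ φᶜ q
  φᶜ-swap zero          = refl
  φᶜ-swap (suc zero)    = refl
  φᶜ-swap (suc (suc _)) = refl

  swap-central : ∀ q → swap 2 q ≡ q → ∃ λ i → cen i ≡ at q
  swap-central zero          _  = suc zero , refl
  swap-central (suc zero)    _  = suc (suc zero) , refl
  swap-central (suc (suc x)) eq =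
    ⊥-elim (swap-fixed-point-free even x (suc-injective (suc-injective eq)))

  φ-cen : ∀ i → [ next ∘ proj₁ , φᶜ ]′ (place (cen i)) ≡ next i
  φ-cen zero             = cong [ next ∘ proj₁ , φᶜ ]′ (place-outer zero role-first)
  φ-cen (suc zero)       = cong [ next ∘ proj₁ , φᶜ ]′ (place-at zero)
  φ-cen (suc (suc zero)) = cong [ next ∘ proj₁ , φᶜ ]′ (place-at (suc zero))

  cen-fixed : ∀ i q → place (cen i) ≡ inj₂ q → swap 2 q ≡ q
  cen-fixed zero q eq with trans (sym (place-outer zero role-first)) eq
  ... | ()
  cen-fixed (suc zero) q eq =
    subst (λ q → swap 2 q ≡ q) (inj₂-injective (trans (sym (place-at zero)) eq)) refl
  cen-fixed (suc (suc zero)) q eq =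
    subst (λ q → swap 2 q ≡ q) (inj₂-injective (trans (sym (place-at (suc zero))) eq)) refl

  -- The shift by `next` keeps the first outer part away from the corner that it contains: it hangs
  -- at a corner in the core.
  outer-hub : ∀ {i o} → role i ≡ inj₁ o → proj₁ (cen (next o)) ≢ i
  outer-hub {o = zero}           ro eq = outer≢core ro (sym eq)
  outer-hub {o = suc zero}       ro eq = outer≢core ro (sym eq)
  outer-hub {o = suc (suc zero)} ro refl with trans (sym role-first) ro
  ... | ()

  core-hub : ∀ q → proj₁ (cen (φᶜ q)) ≢ part (inj₂ (column q))
  core-hub zero    = core-part≢ (column-consecutive {suc zero} {zero} (inj₂ refl))
  core-hub (suc q) = outer≢core role-first

  open Construction cen next φᶜ (swap 2) (swap-involutive 2) (swap-consecutive 2) swap-central φᶜ-swap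
    next-injective φ-cen cen-fixed outer-hub core-hub

  construction : ∀ {l} → ∑ (allFin k) isOuter ≡ l →
    ∃ λ (H : Graph V) → C4Saturated H (K k (suc n)) × degreeSum H + (suc n * l + 2) ≤ 3 * (k * suc n)
  construction outer-count =
    graph , saturated , degreeSum-bound {p = zero} {q = suc zero} (λ ()) refl refl outer-count

-- A core with an odd number of vertices.

first₃ : ∀ {m} → Fin 3 → Fin (3 + m)
first₃ i = i ↑ˡ _

-- Where to hang a pair from columns c and d, so that the corner lies in neither.
avoiding : ∀ {m} → Fin (3 + m) → Fin (3 + m) → Fin 3
avoiding zero          zero          = suc zero
avoiding zero          (suc zero)    = suc (suc zero)
avoiding zero          (suc (suc _)) = suc zero
avoiding (suc zero)    zero          = suc (suc zero)
avoiding (suc zero)    (suc _)       = zero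
avoiding (suc (suc _)) zero          = suc zero
avoiding (suc (suc _)) (suc _)       = zero

avoiding-comm : ∀ {m} (c d : Fin (3 + m)) → avoiding c d ≡ avoiding d c
avoiding-comm zero          zero          = refl
avoiding-comm zero          (suc zero)    = refl
avoiding-comm zero          (suc (suc _)) = refl
avoiding-comm (suc zero)    zero          = refl
avoiding-comm (suc zero)    (suc zero)    = refl
avoiding-comm (suc zero)    (suc (suc _)) = refl
avoiding-comm (suc (suc _)) zero          = refl
avoiding-comm (suc (suc _)) (suc zero)    = refl
avoiding-comm (suc (suc _)) (suc (suc _)) = refl

avoiding-≢ : ∀ {m} (c d : Fin (3 + m)) → first₃ (avoiding c d) ≢ c
avoiding-≢ zero          zero          ()
avoiding-≢ zero          (suc zero)    ()
avoiding-≢ zero          (suc (suc _)) ()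
avoiding-≢ (suc zero)    zero          ()
avoiding-≢ (suc zero)    (suc _)       ()
avoiding-≢ (suc (suc _)) zero          ()
avoiding-≢ (suc (suc _)) (suc _)       ()

module OddCore {k n m : ℕ} (role : Fin k → Fin 3 ⊎ Fin (3 + m)) (part : Fin 3 ⊎ Fin (3 + m) → Fin k)
  (part-role : ∀ i → part (role i) ≡ i) (role-core : ∀ c → role (part (inj₂ c)) ≡ inj₂ c)
  (even : parity (m + n * (3 + m)) ≡ 0ℙ) where
  open Vertices {k} {suc n}
  open Grid {k} {suc n} {suc m} role part part-role role-core

  corner : Fin 3 → Pos
  corner zero             = zero
  corner (suc zero)       = suc zero
  corner (suc (suc zero)) = suc (suc zero)

  cen : Fin 3 → V
  cen i = at (corner i)

  column-corner : ∀ i → column (corner i) ≡ first₃ i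
  column-corner zero             = refl
  column-corner (suc zero)       = refl
  column-corner (suc (suc zero)) = refl

  -- All corners lie in the core here, so the corner of a pair depends on its two columns. By
  -- `avoiding-comm` both members choose the same one, so checking each vertex against its own
  -- column in `core-hub` covers the pair.
  φᶜ : Pos → Fin 3
  φᶜ zero                    = suc zero
  φᶜ (suc zero)              = suc (suc zero)
  φᶜ (suc (suc zero))        = zero
  φᶜ q@(suc (suc (suc _)))   = avoiding (column q) (column (swap 3 q))

  φᶜ-swap : ∀ q → φᶜ (swap 3 q) ≡ φᶜ q
  φᶜ-swap zero                    = refl
  φᶜ-swap (suc zero)              = refl
  φᶜ-swap (suc (suc zero))        = refl
  φᶜ-swap q@(suc (suc (suc _))) = trans
    (cong (λ p → avoiding (column (swap 3 q)) (column p)) (swap-involutive 3 q))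
    (avoiding-comm (column (swap 3 q)) (column q))

  swap-central : ∀ q → swap 3 q ≡ q → ∃ λ i → cen i ≡ at q
  swap-central zero                _  = zero , refl
  swap-central (suc zero)          _  = suc zero , refl
  swap-central (suc (suc zero))    _  = suc (suc zero) , refl
  swap-central (suc (suc (suc x))) eq = ⊥-elim (swap-fixed-point-free even x
    (suc-injective (suc-injective (suc-injective eq))))

  φᶜ-corner : ∀ i → φᶜ (corner i) ≡ next i
  φᶜ-corner zero             = refl
  φᶜ-corner (suc zero)       = refl
  φᶜ-corner (suc (suc zero)) = refl

  swap-corner : ∀ i → swap 3 (corner i) ≡ corner i
  swap-corner zero             = refl
  swap-corner (suc zero)       = refl
  swap-corner (suc (suc zero)) = refl

  cen-fixed : ∀ i q → place (cen i) ≡ inj₂ q → swap 3 q ≡ q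
  cen-fixed i q eq =
    subst (λ q → swap 3 q ≡ q) (inj₂-injective (trans (sym (place-at (corner i))) eq)) (swap-corner i)

  core-hub : ∀ q → proj₁ (cen (φᶜ q)) ≢ part (inj₂ (column q))
  core-hub zero             = core-part≢ λ ()
  core-hub (suc zero)       = core-part≢ λ ()
  core-hub (suc (suc zero)) = core-part≢ λ ()
  core-hub q@(suc (suc (suc _))) = core-part≢ (subst (_≢ column q) (sym (column-corner (φᶜ q)))
    (avoiding-≢ (column q) (column (swap 3 q))))

  open Construction cen id φᶜ (swap 3) (swap-involutive 3) (swap-consecutive 3) swap-central φᶜ-swap
    (λ _ _ → id) (λ i → trans (cong [ proj₁ , φᶜ ]′ (place-at (corner i))) (φᶜ-corner i)) cen-fixed
    (λ ro eq → outer≢core ro (sym eq)) core-hub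

  construction : ∀ {l} → ∑ (allFin k) isOuter ≡ l →
    ∃ λ (H : Graph V) → C4Saturated H (K k (suc n)) × degreeSum H + (suc n * l + 2) ≤ 3 * (k * suc n)
  construction outer-count =
    -- Two fixed corners are counted, so that both parities share one bound; the third lowers the
    -- degree sum by one more, which halving rounds away.
    graph , saturated , degreeSum-bound {p = zero} {q = suc zero} (λ ()) refl refl outer-count

-- Edge counts and the choice of parameters.

open Vertices using (degreeSum; edges-degreeSum)

-- `t` stands for the number of vertices in the outer parts. With three outer parts, `s` is the
-- `3 * (k ∸ 1) * n` of the theorem.
edges≤ : ∀ {k n} s t (H : Graph (Vtx k n)) → degreeSum H + (t + 2) ≤ 3 * (k * n) → 3 * (k * n) ≡ s + t →
         edges H ≤ ⌊ (s ∸ 2) /2⌋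
edges≤ {k} {n} s t H bound split = ≤-trans (≤-reflexive (edges-degreeSum H)) (⌊n/2⌋-mono D≤s∸2)
  where
  regroup : ∀ d t → d + (t + 2) ≡ d + 2 + t
  regroup = solve-∀
  D≤s∸2 : degreeSum H ≤ s ∸ 2
  D≤s∸2 = ≤-trans (≤-reflexive (sym (m+n∸n≡m (degreeSum H) 2))) (∸-monoˡ-≤ 2
    (+-cancelʳ-≤ t _ _ (subst₂ _≤_ (regroup (degreeSum H) t) split bound)))

∑-allFin-++ : ∀ l c (f : Fin (l + c) → ℕ) → (∀ i → f (i ↑ˡ c) ≡ 1) → (∀ j → f (l ↑ʳ j) ≡ 0) →
              ∑ (allFin (l + c)) f ≡ l
∑-allFin-++ zero    c f _    zeros = trans (∑-cong (allFin c) zeros) (∑-zero (allFin c))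
∑-allFin-++ (suc l) c f ones zeros =
  trans (∑-allFin-suc (l + c) f) (cong₂ _+_ (ones zero) (∑-allFin-++ l c (f ∘ suc) (ones ∘ suc) zeros))

Sparse : ℕ → ℕ → ℕ → Set
Sparse k n l = ∃ λ (H : Graph (Vtx k n)) → C4Saturated H (K k n) × degreeSum H + (n * l + 2) ≤ 3 * (k * n)

parity-double : ∀ n → parity (n * 2) ≡ 0ℙ
parity-double zero    = refl
parity-double (suc n) = parity-double n

sparse₅ : ∀ k n → Sparse (5 + k) (suc n) 3
sparse₅ k n = by-parity k (parity (k + n * suc (suc k))) refl
  where
  outer-count : ∀ c → ∑ (allFin (3 + c)) (λ i → [ (λ _ → 1) , (λ _ → 0) ]′ (splitAt 3 i)) ≡ 3
  outer-count c = ∑-allFin-++ 3 c (λ i → [ (λ _ → 1) , (λ _ → 0) ]′ (splitAt 3 i))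
    (λ i → cong [ (λ _ → 1) , (λ _ → 0) ]′ (splitAt-↑ˡ 3 i c))
    (λ j → cong [ (λ _ → 1) , (λ _ → 0) ]′ (splitAt-↑ʳ 3 c j))
  by-parity : ∀ k p → parity (k + n * suc (suc k)) ≡ p → Sparse (5 + k) (suc n) 3
  by-parity k 0ℙ even = EvenCore.construction (splitAt 3) (join 3 _) (join-splitAt 3 _) (splitAt-↑ʳ 3 _)
    refl even (outer-count (2 + k))
  -- With five parts the core consists of two parts, so its size is never odd.
  by-parity zero 1ℙ odd with trans (sym odd) (parity-double n)
  ... | ()
  -- Taking three corners from the core instead of two changes the parity of what remains to be
  -- paired.
  by-parity (suc k) 1ℙ odd = OddCore.construction (splitAt 3) (join 3 _) (join-splitAt 3 _) (splitAt-↑ʳ 3 _)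
    (trans (sym (suc-homo-⁻¹ (k + n * (3 + k)))) (cong opposite odd)) (outer-count (3 + k))

-- The two core parts leave only two outer ones, so there are fewer leaves: the degree sum is at
-- most `10 * suc n ∸ 2`, hence the weaker upper bound.
sparse₄ : ∀ n → Sparse 4 (suc n) 2
sparse₄ n = EvenCore.construction {m = 0} role part part-role (λ _ → refl) refl (parity-double n) refl
  where
  role : Fin 4 → Fin 3 ⊎ Fin 2
  role zero          = inj₁ zero
  role (suc zero)    = inj₁ (suc zero)
  role (suc (suc c)) = inj₂ c
  part : Fin 3 ⊎ Fin 2 → Fin 4
  part (inj₁ zero)             = zero
  part (inj₁ (suc zero))       = suc zero
  -- A default value: `role` takes only the first two outer values.
  part (inj₁ (suc (suc zero))) = zero
  part (inj₂ c)                = suc (suc c)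
  part-role : ∀ i → part (role i) ≡ i
  part-role zero          = refl
  part-role (suc zero)    = refl
  part-role (suc (suc c)) = refl

theorem1p9 : ((k n : ℕ) → 5 ≤ k → 1 ≤ n → SatK-C4 k n ⌊ (3 * (k ∸ 1) * n ∸ 2) /2⌋)
    ×
    ((n : ℕ) → 1 ≤ n →
    ((H : Graph (Vtx 4 n)) → C4Saturated H (K 4 n) → ⌊ (9 * n ∸ 2) /2⌋ ≤ edges H)
    ×
    (Σ (Graph (Vtx 4 n)) λ H → C4Saturated H (K 4 n) × edges H ≤ 5 * n ∸ 1))
theorem1p9 = five-parts , four-parts
  where
  five-parts : (k n : ℕ) → 5 ≤ k → 1 ≤ n → SatK-C4 k n ⌊ (3 * (k ∸ 1) * n ∸ 2) /2⌋
  five-parts _ (suc n) (s≤s (s≤s (s≤s (s≤s (s≤s (z≤n {k})))))) 1≤n =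
    (H , sat , ≤-antisym (edges≤ (3 * (4 + k) * suc n) (suc n * 3) H few (split (4 + k) (suc n)))
                         (LowerBound.edges-bound H sat 1≤n)) ,
    λ H sat → LowerBound.edges-bound H sat 1≤n
    where
    split : ∀ k n → 3 * (suc k * n) ≡ 3 * k * n + n * 3
    split = solve-∀
    H = proj₁ (sparse₅ k n)
    sat = proj₁ (proj₂ (sparse₅ k n))
    few = proj₂ (proj₂ (sparse₅ k n))
  four-parts : (n : ℕ) → 1 ≤ n →
    ((H : Graph (Vtx 4 n)) → C4Saturated H (K 4 n) → ⌊ (9 * n ∸ 2) /2⌋ ≤ edges H) ×
    (Σ (Graph (Vtx 4 n)) λ H → C4Saturated H (K 4 n) × edges H ≤ 5 * n ∸ 1)
  four-parts (suc n) 1≤n = (λ H sat → LowerBound.edges-bound H sat 1≤n) , H , sat ,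
    ≤-trans (edges≤ (10 * suc n) (suc n * 2) H few (split (suc n))) (≤-reflexive (half n))
    where
    split : ∀ n → 3 * (4 * n) ≡ 10 * n + n * 2
    split = solve-∀
    double : ∀ n → 10 * suc n ≡ 2 + ((5 * n + 4) + (5 * n + 4))
    double = solve-∀
    predecessor : ∀ n → 5 * suc n ≡ 1 + (5 * n + 4)
    predecessor = solve-∀
    half : ∀ n → ⌊ (10 * suc n ∸ 2) /2⌋ ≡ 5 * suc n ∸ 1
    half n = trans (cong (λ x → ⌊ (x ∸ 2) /2⌋) (double n))
      (trans (⌊q+q/2⌋ (5 * n + 4)) (cong (_∸ 1) (sym (predecessor n))))
    H = proj₁ (sparse₄ n)
    sat = proj₁ (proj₂ (sparse₄ n))
    few = proj₂ (proj₂ (sparse₄ n))
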